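{- Let $k$ and $n$ be positive integers. Let $d_1,\dots,d_r$ be the positive divisors of $k$ whose $2$-adic valuation equals that of $k$, and let $$S_k(n)=\left\{(a_1,\dots,a_r)\in\mathbb{Z}_{\ge0}^r \;:\; \sum_{i=1}^r a_id_i=\left\lfloor \tfrac n2\right\rfloor\right\}.$$ Then the number of $\pi\in\mathcal{S}_n$ such that $\pi^k$ is the decreasing permutation $w_0$ (given by $w_0(i)=n+1-i$) is $$\sum_{(a_1,\dots,a_r)\in S_k(n)}\frac{\lfloor n/2\rfloor!\cdot\prod_{i=1}^r 2^{a_i(d_i-1)}}{\prod_{i=1}^r a_i!\,d_i^{a_i}}.$$
   Context: $\mathcal{S}_n$ is the symmetric group on $[n]=\{1,\dots,n\}$. The $2$-adic valuation of a positive integer is the exponent of $2$ in its prime factorization. -}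

module Defs where

open import Data.Nat using (ℕ; zero; suc; _+_; _*_; _∸_; _^_; _≤_; _/_; _%_; _!)
open import Data.Nat.Properties using (_≟_; m*n≢0; m^n≢0; _!≢0)
open import Data.Nat.Divisibility using (_∣_; _∣?_)
open import Data.Bool using (if_then_else_)
open import Data.Nat using (_≡ᵇ_)
open import Data.Fin using (Fin; opposite)
import Data.Fin.Properties as FinP
open import Data.Vec using (Vec; []; _∷_; lookup)
open import Data.List using (allFin; List; []; _∷_; map; concatMap; filter; length; upTo; foldr; zipWith)
open import Data.Product using (_×_)
open import Relation.Nullary.Decidable using (Dec; _×-dec_; _→-dec_)
open import Relation.Binary.PropositionalEquality using (_≡_)
open import Data.Integer using (+_)
open import Data.Rational using (ℚ; 0ℚ; 1ℚ) renaming (_+_ to _+ℚ_; _*_ to _*ℚ_; _/_ to _/ℚ_)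

-- Permutations of [n] are encoded (0-indexed) as Fin n; a candidate map
-- Fin n → Fin n is given by its table of values (a Vec (Fin n) n).

allVecs : (n m : ℕ) → List (Vec (Fin n) m)
allVecs n zero    = [] ∷ []
allVecs n (suc m) = concatMap (λ x → map (x ∷_) (allVecs n m)) (allFin n)

pow : {n : ℕ} → (Fin n → Fin n) → ℕ → Fin n → Fin n
pow f zero    i = i
pow f (suc k) i = f (pow f k i)

-- the decreasing permutation w₀(i) = n+1-i  (0-indexed: i ↦ n-1-i)
w₀ : {n : ℕ} → Fin n → Fin n
w₀ = opposite

-- the table v is a permutation of [n] (injective, hence bijective on Fin n)
IsPerm : {n : ℕ} → Vec (Fin n) n → Set
IsPerm v = ∀ i j → lookup v i ≡ lookup v j → i ≡ j

Good : (k : ℕ) {n : ℕ} → Vec (Fin n) n → Set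
Good k v = IsPerm v × (∀ i → pow (lookup v) k i ≡ w₀ i)

good? : (k : ℕ) {n : ℕ} (v : Vec (Fin n) n) → Dec (Good k v)
good? k v =
  FinP.all? (λ i → FinP.all? (λ j → (lookup v i FinP.≟ lookup v j) →-dec (i FinP.≟ j)))
  ×-dec FinP.all? (λ i → pow (lookup v) k i FinP.≟ w₀ i)

countRoots : (k n : ℕ) → ℕ
countRoots k n = length (filter (good? k) (allVecs n n))

-- 2-adic valuation (with fuel; fuel = n suffices for n ≥ 1)

v2aux : ℕ → ℕ → ℕ
v2aux zero    n = 0
v2aux (suc f) zero = 0
v2aux (suc f) (suc n) = if (suc n % 2 ≡ᵇ 0) then suc (v2aux f (suc n / 2)) else 0

v2 : ℕ → ℕ
v2 n = v2aux n n

-- The divisors d₁,…,d_r of k with v2 d = v2 k, each stored as its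
-- predecessor p = d - 1 (so d = suc p is visibly nonzero), in increasing order.
divPreds : ℕ → List ℕ
divPreds k = filter (λ p → (suc p ∣? k) ×-dec (v2 (suc p) ≟ v2 k)) (upTo k)

tuples : ℕ → ℕ → List (List ℕ)
tuples zero    m = [] ∷ []
tuples (suc r) m = concatMap (λ a → map (a ∷_) (tuples r m)) (upTo (suc m))

weighted : List ℕ → List ℕ → ℕ
weighted ps as = foldr _+_ 0 (zipWith (λ p a → a * suc p) ps as)

-- S_k(n): tuples (a_i) ∈ ℕ^r with Σ a_i d_i = ⌊n/2⌋
-- (every such tuple has all a_i ≤ ⌊n/2⌋ since d_i ≥ 1)
S : ℕ → ℕ → List (List ℕ)
S k n = filter (λ as → weighted (divPreds k) as ≟ n / 2)
               (tuples (length (divPreds k)) (n / 2))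

factor : ℕ → ℕ → ℚ
factor p a = _/ℚ_ (+ (2 ^ (a * p))) (a ! * suc p ^ a)
               {{m*n≢0 (a !) (suc p ^ a) {{a !≢0}} {{m^n≢0 (suc p) a}}}}

prodℚ : List ℚ → ℚ
prodℚ = foldr _*ℚ_ 1ℚ

sumℚ : List ℚ → ℚ
sumℚ = foldr _+ℚ_ 0ℚ

term : ℕ → ℕ → List ℕ → ℚ
term k n as = (+ ((n / 2) !) /ℚ 1) *ℚ prodℚ (zipWith factor (divPreds k) as)

formula : ℕ → ℕ → ℚ
formula k n = sumℚ (map (term k n) (S k n))

{-# OPTIONS --safe #-}
-- If π^k = w₀ then π commutes with w₀, and the π-orbit of a point moved by w₀ has length 2d, with
-- π^d = w₀ on it, for some d such that k = d · (odd number); these are exactly the dᵢ.  Constructing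
-- π orbit by orbit, one pair {x, w₀ x} at a time, gives for m = ⌊n/2⌋ the recursion
--   F(m) = ∑_d (2m-2)(2m-4)⋯(2m-2d+2) F(m-d),  i.e.  m G(m) = ∑_d 2^(d-1) G(m-d)  for G(m) = F(m)/m!.
-- The right-hand side of the formula, divided by m!, is the coefficient of x^m in
-- ∏_d exp(2^(d-1) x^d / d), whose logarithmic derivative yields the same recursion.
module Submission where

open import Defs
open import Algebra.Bundles using (CommutativeRing; CommutativeSemiring)
open import Data.Fin.Base as Fin using (Fin; fromℕ<; opposite; toℕ)
import Data.Fin.Properties as Fin
import Data.Integer.Base as ℤ
import Data.Integer.Properties as ℤ
open import Data.List.Base using (List; []; _∷_; _++_; allFin; concatMap; filter; foldr;
  length; map; upTo; zipWith)
import Data.List.Properties as List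
open import Data.Nat using (ℕ; _≤_)
open import Data.Nat.Base as ℕ using (zero; suc; z≤n; s≤s; _<_; _^_; _!; _∸_; NonZero)
open import Data.Nat.Divisibility using (_∣_; _∣?_; divides; ∣⇒≤)
open import Data.Nat.DivMod using (m*n/n≡m; m*n%n≡0; [m+kn]%n≡m%n; m≡m%n+[m/n]*n; m%n<n)
import Data.Nat.Properties as ℕ
import Data.Nat.Solver as ℕ
open import Data.Product.Base using (_×_; _,_; proj₁; proj₂; ∃)
import Data.Rational.Properties as ℚ
import Data.Rational.Solver as ℚ
open import Data.Rational.Unnormalised.Base as ℚᵘ using (mkℚᵘ; *≡*; _≃_)
import Data.Rational.Unnormalised.Properties as ℚᵘ
open import Data.Sum.Base using (_⊎_; inj₁; inj₂)
open import Data.Vec.Base using (Vec; []; _∷_; lookup; tabulate)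
import Data.Vec.Properties as Vec
open import Function.Base using (_∘_; id)
open import Function.Bundles using (_⇔_; mk⇔; Equivalence)
open import Level using (0ℓ)
open import Relation.Binary.PropositionalEquality
  using (_≡_; _≢_; refl; sym; trans; cong; cong₂; subst; module ≡-Reasoning)
open import Relation.Nullary.Decidable
  using (Dec; yes; no; ¬?; _×-dec_; _⊎-dec_; _→-dec_; decidable-stable)
open import Relation.Nullary.Negation using (¬_; contradiction)
open import Relation.Unary using (Pred; Decidable)

-- A recursion over whole orbits would require counting injective sequences and relabelling the
-- remaining points. Instead, each orbit is built one value at a time: a partial root is a predicate
-- on `Fin n` together with a map whose values matter only there, all counts range over the same
-- list of tables, and a step sorts the tables by their value at a single point. The number of
-- completions depends only on how many points are untouched and, inside an orbit, on how many steps
-- it has made; hence the two functions `Q` and `R`. On the side of the formula, the tuples have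
-- bounded entries, while the recursion relates coefficients of different degrees. The bound M is
-- therefore kept fixed and separate from the degree m ≤ M; the one term that the bound cuts off in
-- the derivative has degree above M.

module Summation (R : CommutativeSemiring 0ℓ 0ℓ) where

  open CommutativeSemiring R renaming (Carrier to C; refl to ≈-refl; sym to ≈-sym; trans to ≈-trans)
  open import Relation.Binary.Reasoning.Setoid setoid
  open import Algebra.Properties.CommutativeSemigroup +-commutativeSemigroup using (interchange)

  private variable
    A B D : Set
    P Q : Set

  -- The Iverson bracket. Taking its values in the semiring lets counts over ℕ and coefficient sums
  -- over ℚ share the same rules for swapping and factoring.
  ⟦_⟧ : Dec P → C
  ⟦ yes _ ⟧ = 1#
  ⟦ no _ ⟧  = 0#

  ⟦⟧-yes : P → (P? : Dec P) → ⟦ P? ⟧ ≈ 1#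
  ⟦⟧-yes p (yes _) = ≈-refl
  ⟦⟧-yes p (no ¬p) = contradiction p ¬p

  ⟦⟧-no : ¬ P → (P? : Dec P) → ⟦ P? ⟧ ≈ 0#
  ⟦⟧-no ¬p (yes p) = contradiction p ¬p
  ⟦⟧-no ¬p (no _)  = ≈-refl

  ⟦⟧-cong : (P → Q) → (Q → P) → (P? : Dec P) (Q? : Dec Q) → ⟦ P? ⟧ ≈ ⟦ Q? ⟧
  ⟦⟧-cong f g (yes p) Q? = ≈-sym (⟦⟧-yes (f p) Q?)
  ⟦⟧-cong f g (no ¬p) Q? = ≈-sym (⟦⟧-no (¬p ∘ g) Q?)

  ⟦⟧-× : (P? : Dec P) (Q? : Dec Q) → ⟦ P? ×-dec Q? ⟧ ≈ ⟦ P? ⟧ * ⟦ Q? ⟧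
  ⟦⟧-× (yes _) (yes _) = ≈-sym (*-identityʳ 1#)
  ⟦⟧-× (yes _) (no _)  = ≈-sym (zeroʳ 1#)
  ⟦⟧-× (no _)  Q?      = ≈-sym (zeroˡ _)

  ∑ : List A → (A → C) → C
  ∑ xs f = foldr _+_ 0# (map f xs)

  ∑-cong : (xs : List A) {f g : A → C} → (∀ x → f x ≈ g x) → ∑ xs f ≈ ∑ xs g
  ∑-cong []       f≈g = ≈-refl
  ∑-cong (x ∷ xs) f≈g = +-cong (f≈g x) (∑-cong xs f≈g)

  ∑-++ : (xs ys : List A) (f : A → C) → ∑ (xs ++ ys) f ≈ ∑ xs f + ∑ ys f
  ∑-++ []       ys f = ≈-sym (+-identityˡ _)
  ∑-++ (x ∷ xs) ys f = ≈-trans (+-congˡ (∑-++ xs ys f)) (≈-sym (+-assoc _ _ _))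

  ∑-map : (h : A → B) (xs : List A) (f : B → C) → ∑ (map h xs) f ≈ ∑ xs (f ∘ h)
  ∑-map h []       f = ≈-refl
  ∑-map h (x ∷ xs) f = +-congˡ (∑-map h xs f)

  ∑-concatMap : (h : A → List B) (xs : List A) (f : B → C) →
                ∑ (concatMap h xs) f ≈ ∑ xs (λ x → ∑ (h x) f)
  ∑-concatMap h []       f = ≈-refl
  ∑-concatMap h (x ∷ xs) f =
    ≈-trans (∑-++ (h x) (concatMap h xs) f) (+-congˡ (∑-concatMap h xs f))

  ∑-cartesian : (h : A → B → D) (xs : List A) (ys : List B) (f : D → C) →
                ∑ (concatMap (λ x → map (h x) ys) xs) f ≈ ∑ xs (λ x → ∑ ys (λ y → f (h x y)))
  ∑-cartesian h xs ys f =
    ≈-trans (∑-concatMap (λ x → map (h x) ys) xs f) (∑-cong xs (λ x → ∑-map (h x) ys f))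

  ∑-zero : (xs : List A) → ∑ xs (λ _ → 0#) ≈ 0#
  ∑-zero []       = ≈-refl
  ∑-zero (x ∷ xs) = ≈-trans (+-identityˡ _) (∑-zero xs)

  ∑-+ : (xs : List A) (f g : A → C) → ∑ xs (λ x → f x + g x) ≈ ∑ xs f + ∑ xs g
  ∑-+ []       f g = ≈-sym (+-identityˡ _)
  ∑-+ (x ∷ xs) f g = ≈-trans (+-congˡ (∑-+ xs f g)) (interchange (f x) (g x) (∑ xs f) (∑ xs g))

  ∑-*ˡ : (c : C) (xs : List A) (f : A → C) → ∑ xs (λ x → c * f x) ≈ c * ∑ xs f
  ∑-*ˡ c []       f = ≈-sym (zeroʳ c)
  ∑-*ˡ c (x ∷ xs) f = ≈-trans (+-congˡ (∑-*ˡ c xs f)) (≈-sym (distribˡ c (f x) (∑ xs f)))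

  ∑-*ʳ : (c : C) (xs : List A) (f : A → C) → ∑ xs (λ x → f x * c) ≈ ∑ xs f * c
  ∑-*ʳ c xs f =
    ≈-trans (∑-cong xs (λ x → *-comm (f x) c)) (≈-trans (∑-*ˡ c xs f) (*-comm c (∑ xs f)))

  ∑-swap : (xs : List A) (ys : List B) (f : A → B → C) →
           ∑ xs (λ x → ∑ ys (f x)) ≈ ∑ ys (λ y → ∑ xs (λ x → f x y))
  ∑-swap []       ys f = ≈-sym (∑-zero ys)
  ∑-swap (x ∷ xs) ys f =
    ≈-trans (+-congˡ (∑-swap xs ys f)) (≈-sym (∑-+ ys (f x) (λ y → ∑ xs (λ x → f x y))))

  ∑-filter : {P : Pred A 0ℓ} (P? : Decidable P) (xs : List A) (f : A → C) →
             ∑ (filter P? xs) f ≈ ∑ xs (λ x → ⟦ P? x ⟧ * f x)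
  ∑-filter P? []       f = ≈-refl
  ∑-filter P? (x ∷ xs) f with P? x
  ... | yes _ = +-cong (≈-sym (*-identityˡ (f x))) (∑-filter P? xs f)
  ... | no _  = begin
    ∑ (filter P? xs) f                          ≈⟨ ∑-filter P? xs f ⟩
    ∑ xs (λ y → ⟦ P? y ⟧ * f y)                 ≈⟨ +-identityˡ _ ⟨
    0# + ∑ xs (λ y → ⟦ P? y ⟧ * f y)            ≈⟨ +-congʳ (zeroˡ (f x)) ⟨
    0# * f x + ∑ xs (λ y → ⟦ P? y ⟧ * f y)      ∎

  ∑-upTo-suc : (f : ℕ → C) (m : ℕ) → ∑ (upTo (suc m)) f ≈ f 0 + ∑ (upTo m) (f ∘ suc)
  ∑-upTo-suc f m = +-congˡ
    (≈-trans (reflexive (cong (λ xs → ∑ xs f) (sym (List.map-upTo suc m)))) (∑-map suc (upTo m) f))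

  ∑-upTo-last : (f : ℕ → C) (m : ℕ) → ∑ (upTo (suc m)) f ≈ ∑ (upTo m) f + f m
  ∑-upTo-last f m = begin
    ∑ (upTo (suc m)) f             ≡⟨ cong (λ xs → ∑ xs f) (List.upTo-∷ʳ m) ⟨
    ∑ (upTo m ++ m ∷ []) f         ≈⟨ ∑-++ (upTo m) (m ∷ []) f ⟩
    ∑ (upTo m) f + (f m + 0#)      ≈⟨ +-congˡ (+-identityʳ (f m)) ⟩
    ∑ (upTo m) f + f m             ∎

module ∑ℕ = Summation ℕ.+-*-commutativeSemiring

-- Counting by indicator sums over lists and over `Fin n`.

module Counting where

  open ∑ℕ
  open import Data.Nat.Base using (_+_)

  length-filter : {A : Set} {P : Pred A 0ℓ} (P? : Decidable P) (xs : List A) →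
                  length (filter P? xs) ≡ ∑ xs (λ x → ⟦ P? x ⟧)
  length-filter P? []       = refl
  length-filter P? (x ∷ xs) with P? x
  ... | yes _ = cong suc (length-filter P? xs)
  ... | no _  = length-filter P? xs

  ⟦⟧+⟦¬⟧ : {P : Set} (P? : Dec P) → ⟦ P? ⟧ + ⟦ ¬? P? ⟧ ≡ 1
  ⟦⟧+⟦¬⟧ (yes _) = refl
  ⟦⟧+⟦¬⟧ (no _)  = refl

  ∑-one : {A : Set} (xs : List A) → ∑ xs (λ _ → 1) ≡ length xs
  ∑-one []       = refl
  ∑-one (x ∷ xs) = cong suc (∑-one xs)

  ∑-allFin-suc : (n : ℕ) (f : Fin (suc n) → ℕ) →
                 ∑ (allFin (suc n)) f ≡ f Fin.zero + ∑ (allFin n) (f ∘ Fin.suc)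
  ∑-allFin-suc n f = cong (f Fin.zero +_)
    (trans (cong (λ xs → ∑ xs f) (sym (List.map-tabulate id Fin.suc))) (∑-map Fin.suc (allFin n) f))

  ∑-upTo-≟ : {j m : ℕ} → j < m → ∑ (upTo m) (λ p → ⟦ p ℕ.≟ j ⟧) ≡ 1
  ∑-upTo-≟ {zero}  {suc m} _         =
    trans (∑-upTo-suc (λ p → ⟦ p ℕ.≟ 0 ⟧) m)
      (cong suc (trans (∑-cong (upTo m) (λ p → ⟦⟧-no (λ ()) (suc p ℕ.≟ 0))) (∑-zero (upTo m))))
  ∑-upTo-≟ {suc j} {suc m} (s≤s j<m) =
    trans (∑-upTo-suc (λ p → ⟦ p ℕ.≟ suc j ⟧) m)
      (trans (∑-cong (upTo m) (λ p → ⟦⟧-cong ℕ.suc-injective (cong suc) (suc p ℕ.≟ suc j) (p ℕ.≟ j)))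
             (∑-upTo-≟ j<m))

  ∑-allFin-≟ : {n : ℕ} (i : Fin n) → ∑ (allFin n) (λ x → ⟦ x Fin.≟ i ⟧) ≡ 1
  ∑-allFin-≟ {suc n} Fin.zero    =
    trans (∑-allFin-suc n (λ x → ⟦ x Fin.≟ Fin.zero ⟧))
      (cong suc (trans (∑-cong (allFin n) (λ x → ⟦⟧-no (λ ()) (Fin.suc x Fin.≟ Fin.zero))) (∑-zero (allFin n))))
  ∑-allFin-≟ {suc n} (Fin.suc i) =
    trans (∑-allFin-suc n (λ x → ⟦ x Fin.≟ Fin.suc i ⟧))
      (trans (∑-cong (allFin n)
               (λ x → ⟦⟧-cong Fin.suc-injective (cong Fin.suc) (Fin.suc x Fin.≟ Fin.suc i) (x Fin.≟ i)))
             (∑-allFin-≟ i))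

  # : {n : ℕ} {P : Pred (Fin n) 0ℓ} → Decidable P → ℕ
  # {n} P? = ∑ (allFin n) (λ x → ⟦ P? x ⟧)

  module _ {n : ℕ} {P : Pred (Fin n) 0ℓ} (P? : Decidable P) where

    #≡0 : (∀ x → ¬ P x) → # P? ≡ 0
    #≡0 ¬p = trans (∑-cong (allFin n) (λ x → ⟦⟧-no (¬p x) (P? x))) (∑-zero (allFin n))

    #≡1 : (y : Fin n) → P y → (∀ x → P x → x ≡ y) → # P? ≡ 1
    #≡1 y py unique = trans
      (∑-cong (allFin n) (λ x → ⟦⟧-cong (unique x) (λ { refl → py }) (P? x) (x Fin.≟ y)))
      (∑-allFin-≟ y)

    #-complement : # P? + # (¬? ∘ P?) ≡ n
    #-complement = trans (sym (∑-+ (allFin n) _ _))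
      (trans (∑-cong (allFin n) (λ x → ⟦⟧+⟦¬⟧ (P? x)))
        (trans (∑-one (allFin n)) (List.length-tabulate {n = n} id)))

    #-remove : (y : Fin n) → P y → # P? ≡ suc (# (λ x → P? x ×-dec ¬? (x Fin.≟ y)))
    #-remove y py = trans (∑-cong (allFin n) pointwise)
      (trans (∑-+ (allFin n) _ _) (cong (_+ # (λ x → P? x ×-dec ¬? (x Fin.≟ y))) (∑-allFin-≟ y)))
      where
      pointwise : ∀ x → ⟦ P? x ⟧ ≡ ⟦ x Fin.≟ y ⟧ + ⟦ P? x ×-dec ¬? (x Fin.≟ y) ⟧
      pointwise x with P? x | x Fin.≟ y
      ... | yes _ | yes _   = refl
      ... | yes _ | no _    = refl
      ... | no ¬p | yes refl = contradiction py ¬p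
      ... | no _  | no _    = refl

    #≡0⇒¬ : # P? ≡ 0 → ∀ x → ¬ P x
    #≡0⇒¬ eq x px with trans (sym eq) (#-remove x px)
    ... | ()

  #-cong : {n : ℕ} {P Q : Pred (Fin n) 0ℓ} (P? : Decidable P) (Q? : Decidable Q) →
           (∀ x → P x → Q x) → (∀ x → Q x → P x) → # P? ≡ # Q?
  #-cong {n} P? Q? f g = ∑-cong (allFin n) (λ x → ⟦⟧-cong (f x) (g x) (P? x) (Q? x))

-- Counting the k-th roots of an involution.

module RootCounting where

  open import Data.Nat.Base using (_+_; _*_; _/_; _%_; s≤s⁻¹)
  open ∑ℕ
  open Counting

  -- Q χ u counts the ways to complete a partial root when 2u points are still unassigned.
  -- R χ u j counts them when in addition an orbit x₀ ↦ ⋯ ↦ xⱼ is under construction: f xⱼ is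
  -- either w₀ x₀, closing a cycle of length 2(j+1), or one of the 2u untouched points.
  mutual

    Q : (ℕ → ℕ) → ℕ → ℕ
    Q χ zero    = 1
    Q χ (suc u) = R χ u 0

    R : (ℕ → ℕ) → ℕ → ℕ → ℕ
    R χ zero    j = χ j * Q χ 0
    R χ (suc u) j = χ j * Q χ (suc u) + suc u * 2 * R χ u (suc j)

  R-cong : {χ χ′ : ℕ → ℕ} → (∀ j → χ j ≡ χ′ j) → ∀ u j → R χ u j ≡ R χ′ u j
  R-cong         χ≗ zero          j = cong (_* 1) (χ≗ j)
  R-cong {χ}{χ′} χ≗ (suc zero)    j = cong₂ (λ x y → x + 2 * y) (cong₂ _*_ (χ≗ j) (R-cong χ≗ 0 0)) (R-cong χ≗ 0 (suc j))
  R-cong         χ≗ (suc (suc u)) j =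
    cong₂ (λ x y → x + suc (suc u) * 2 * y) (cong₂ _*_ (χ≗ j) (R-cong χ≗ (suc u) 0)) (R-cong χ≗ (suc u) (suc j))

  Q-cong : {χ χ′ : ℕ → ℕ} → (∀ j → χ j ≡ χ′ j) → ∀ u → Q χ u ≡ Q χ′ u
  Q-cong χ≗ zero    = refl
  Q-cong χ≗ (suc u) = R-cong χ≗ u 0

  even⊎odd : ∀ q → ∃ (λ h → q ≡ h * 2) ⊎ ∃ (λ h → q ≡ suc (h * 2))
  even⊎odd zero    = inj₁ (0 , refl)
  even⊎odd (suc q) with even⊎odd q
  ... | inj₁ (h , refl) = inj₂ (h , refl)
  ... | inj₂ (h , refl) = inj₁ (suc h , refl)

  module _ {n : ℕ} (f : Fin n → Fin n) where

    pow-+ : ∀ m l i → pow f (m + l) i ≡ pow f m (pow f l i)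
    pow-+ zero    l i = refl
    pow-+ (suc m) l i = cong f (pow-+ m l i)

    pow-suc : ∀ m i → pow f (suc m) i ≡ pow f m (f i)
    pow-suc zero    i = refl
    pow-suc (suc m) i = cong f (pow-suc m i)

    pow-comm : (h : Fin n → Fin n) → (∀ i → f (h i) ≡ h (f i)) → ∀ m i → pow f m (h i) ≡ h (pow f m i)
    pow-comm h fh zero    i = refl
    pow-comm h fh (suc m) i = trans (cong f (pow-comm h fh m i)) (fh (pow f m i))

    pow-pow : ∀ m l i → pow f m (pow f l i) ≡ pow f l (pow f m i)
    pow-pow m l i = trans (sym (pow-+ m l i)) (trans (cong (λ s → pow f s i) (ℕ.+-comm m l)) (pow-+ l m i))

    pow-period : ∀ {d i} → pow f d i ≡ i → ∀ q → pow f (q * d) i ≡ i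
    pow-period         eq zero    = refl
    pow-period {d} {i} eq (suc q) =
      trans (pow-+ d (q * d) i) (trans (cong (pow f d) (pow-period eq q)) eq)

    pow-cycle : ∀ {d i} → pow f (suc d) i ≡ i → ∀ k → pow f k i ≡ pow f (k % suc d) i
    pow-cycle {d} {i} eq k = trans (cong (λ s → pow f s i) (m≡m%n+[m/n]*n k (suc d)))
      (trans (pow-+ (k % suc d) (k / suc d * suc d) i) (cong (pow f (k % suc d)) (pow-period eq (k / suc d))))

  module _ {n : ℕ} where

    -- The bracket for a cons factors into head and tail. The result is what makes a fully
    -- determined partial root count exactly once.
    ∑-allVecs-≟ : ∀ {m} (w : Vec (Fin n) m) → ∑ (allVecs n m) (λ v → ⟦ Vec.≡-dec Fin._≟_ v w ⟧) ≡ 1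
    ∑-allVecs-≟ []              = refl
    ∑-allVecs-≟ {suc m} (y ∷ w) = begin
      ∑ (allVecs n (suc m)) (λ v → ⟦ Vec.≡-dec Fin._≟_ v (y ∷ w) ⟧)
        ≡⟨ ∑-cartesian _∷_ (allFin n) (allVecs n m) (λ v → ⟦ Vec.≡-dec Fin._≟_ v (y ∷ w) ⟧) ⟩
      ∑ (allFin n) (λ x → ∑ (allVecs n m) (λ v → ⟦ Vec.≡-dec Fin._≟_ (x ∷ v) (y ∷ w) ⟧))
        ≡⟨ ∑-cong (allFin n) inner ⟩
      ∑ (allFin n) (λ x → ⟦ x Fin.≟ y ⟧)
        ≡⟨ ∑-allFin-≟ y ⟩
      1 ∎
      where
      open ≡-Reasoning
      factorise : ∀ x v → ⟦ Vec.≡-dec Fin._≟_ (x ∷ v) (y ∷ w) ⟧ ≡ ⟦ x Fin.≟ y ⟧ * ⟦ Vec.≡-dec Fin._≟_ v w ⟧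
      factorise x v = trans
        (⟦⟧-cong Vec.∷-injective (λ { (refl , refl) → refl })
          (Vec.≡-dec Fin._≟_ (x ∷ v) (y ∷ w)) (x Fin.≟ y ×-dec Vec.≡-dec Fin._≟_ v w))
        (⟦⟧-× (x Fin.≟ y) (Vec.≡-dec Fin._≟_ v w))
      inner : ∀ x → ∑ (allVecs n m) (λ v → ⟦ Vec.≡-dec Fin._≟_ (x ∷ v) (y ∷ w) ⟧) ≡ ⟦ x Fin.≟ y ⟧
      inner x = begin
        ∑ (allVecs n m) (λ v → ⟦ Vec.≡-dec Fin._≟_ (x ∷ v) (y ∷ w) ⟧)
          ≡⟨ ∑-cong (allVecs n m) (factorise x) ⟩
        ∑ (allVecs n m) (λ v → ⟦ x Fin.≟ y ⟧ * ⟦ Vec.≡-dec Fin._≟_ v w ⟧)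
          ≡⟨ ∑-*ˡ ⟦ x Fin.≟ y ⟧ (allVecs n m) _ ⟩
        ⟦ x Fin.≟ y ⟧ * ∑ (allVecs n m) (λ v → ⟦ Vec.≡-dec Fin._≟_ v w ⟧)
          ≡⟨ cong (⟦ x Fin.≟ y ⟧ *_) (∑-allVecs-≟ w) ⟩
        ⟦ x Fin.≟ y ⟧ * 1
          ≡⟨ ℕ.*-identityʳ _ ⟩
        ⟦ x Fin.≟ y ⟧ ∎

  -- The decreasing permutation is replaced by an arbitrary involution `ι`. As in `divPreds`, `D j`
  -- refers to the half-length j + 1. The exponent is given by its predecessor, since f^(k-1) is
  -- needed to invert f.
  module Roots {n : ℕ} (ι : Fin n → Fin n) (ι-involutive : ∀ z → ι (ι z) ≡ z) (k-1 : ℕ)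
               {D : Pred ℕ 0ℓ} (D? : Decidable D)
               (D⇔ : ∀ j → D j ⇔ ∃ (λ q → suc k-1 ≡ suc (q * 2) * suc j)) where

    open ≡-Reasoning

    private
      k : ℕ
      k = suc k-1

    χ : ℕ → ℕ
    χ j = ⟦ D? j ⟧

    ι-adjoint : ∀ {y z} → ι y ≡ z → y ≡ ι z
    ι-adjoint {y} refl = sym (ι-involutive y)

    Equivariant : (Fin n → Fin n) → Set
    Equivariant f = ∀ z → f (ι z) ≡ ι (f z)

    Root : (Fin n → Fin n) → Set
    Root f = ∀ i → pow f k i ≡ ι i

    module _ {f : Fin n → Fin n} (root : Root f) where

      -- The map ι ∘ f^(k-1) is a left inverse of f.
      root-injective : ∀ {i j} → f i ≡ f j → i ≡ j
      root-injective {i} {j} eq = begin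
        i                    ≡⟨ ι-involutive i ⟨
        ι (ι i)              ≡⟨ cong ι (root i) ⟨
        ι (pow f k i)        ≡⟨ cong ι (pow-suc f k-1 i) ⟩
        ι (pow f k-1 (f i))  ≡⟨ cong (ι ∘ pow f k-1) eq ⟩
        ι (pow f k-1 (f j))  ≡⟨ cong ι (pow-suc f k-1 j) ⟨
        ι (pow f k j)        ≡⟨ cong ι (root j) ⟩
        ι (ι j)              ≡⟨ ι-involutive j ⟩
        j                    ∎

      -- Here `ι` is a power of f, and f commutes with its powers.
      root-equivariant : Equivariant f
      root-equivariant z = begin
        f (ι z)        ≡⟨ cong f (root z) ⟨
        pow f (suc k) z ≡⟨ pow-suc f k z ⟩
        pow f k (f z)  ≡⟨ root (f z) ⟩
        ι (f z)        ∎

    module _ {f : Fin n → Fin n} (equi : Equivariant f) {a : Fin n} {d : ℕ} (half : pow f d a ≡ ι a) where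

      -- Equivariance turns f^d a = ι a into f^d (ι a) = a, so `a` has period 2d.
      pow-even-multiple : ∀ h → pow f (h * 2 * d) a ≡ a
      pow-even-multiple h = begin
        pow f (h * 2 * d) a        ≡⟨ cong (λ s → pow f s a) (ℕ.*-assoc h 2 d) ⟩
        pow f (h * (2 * d)) a      ≡⟨ pow-period f full h ⟩
        a                          ∎
        where
        full : pow f (2 * d) a ≡ a
        full = begin
          pow f (d + (d + 0)) a    ≡⟨ cong (λ s → pow f (d + s) a) (ℕ.+-identityʳ d) ⟩
          pow f (d + d) a          ≡⟨ pow-+ f d d a ⟩
          pow f d (pow f d a)      ≡⟨ cong (pow f d) half ⟩
          pow f d (ι a)            ≡⟨ pow-comm f ι equi d a ⟩
          ι (pow f d a)            ≡⟨ cong ι half ⟩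
          ι (ι a)                  ≡⟨ ι-involutive a ⟩
          a                        ∎

      pow-odd-multiple : ∀ h → pow f (suc (h * 2) * d) a ≡ ι a
      pow-odd-multiple h =
        trans (pow-+ f d (h * 2 * d) a) (trans (cong (pow f d) (pow-even-multiple h)) half)

    module _ {f : Fin n → Fin n} (equi : Equivariant f) {a : Fin n} (a≢ιa : a ≢ ι a) {j : ℕ}
             (apart : ∀ r → 0 < r → r ≤ j → pow f r a ≢ a × pow f r a ≢ ι a) where

      -- Divide k by j + 1 with remainder r. For an even quotient f^k a is f^r a, which differs from
      -- ι a: by `a≢ιa` if r = 0, by `apart` otherwise. For an odd quotient it is ι (f^r a), so f^r
      -- a = a, and `apart` forces r = 0.
      half-orbit-length : pow f (suc j) a ≡ ι a → pow f k a ≡ ι a → D j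
      half-orbit-length half root = Equivalence.from (D⇔ j)
        (odd (k % suc j) (k / suc j) (m≡m%n+[m/n]*n k (suc j)) (s≤s⁻¹ (m%n<n k (suc j))))
        where
        odd : ∀ r q → k ≡ r + q * suc j → r ≤ j → ∃ λ q → k ≡ suc (q * 2) * suc j
        odd r q k≡ r≤j with even⊎odd q
        odd zero    _ k≡ r≤j | inj₁ (h , refl) = contradiction
          (begin
            a                                ≡⟨ pow-even-multiple equi {d = suc j} half h ⟨
            pow f (h * 2 * suc j) a          ≡⟨ cong (λ s → pow f s a) k≡ ⟨
            pow f k a                        ≡⟨ root ⟩
            ι a                              ∎)
          a≢ιa
        odd (suc r) _ k≡ r≤j | inj₁ (h , refl) = contradiction
          (begin
            pow f (suc r) a
              ≡⟨ cong (pow f (suc r)) (pow-even-multiple equi {d = suc j} half h) ⟨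
            pow f (suc r) (pow f (h * 2 * suc j) a)  ≡⟨ pow-+ f (suc r) (h * 2 * suc j) a ⟨
            pow f (suc r + h * 2 * suc j) a          ≡⟨ cong (λ s → pow f s a) k≡ ⟨
            pow f k a                                ≡⟨ root ⟩
            ι a                                      ∎)
          (proj₂ (apart (suc r) (s≤s z≤n) r≤j))
        odd zero    _ k≡ r≤j | inj₂ (h , refl) = h , k≡
        odd (suc r) _ k≡ r≤j | inj₂ (h , refl) = contradiction
          (trans (ι-adjoint (begin
            ι (pow f (suc r) a)                                ≡⟨ pow-comm f ι equi (suc r) a ⟨
            pow f (suc r) (ι a)
              ≡⟨ cong (pow f (suc r)) (pow-odd-multiple equi {d = suc j} half h) ⟨
            pow f (suc r) (pow f (suc (h * 2) * suc j) a)      ≡⟨ pow-+ f (suc r) (suc (h * 2) * suc j) a ⟨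
            pow f (suc r + suc (h * 2) * suc j) a              ≡⟨ cong (λ s → pow f s a) k≡ ⟨
            pow f k a                                          ≡⟨ root ⟩
            ι a                                                ∎)) (ι-involutive a))
          (proj₁ (apart (suc r) (s≤s z≤n) r≤j))

      -- The powers of f at `a` then depend only on the exponent modulo j + 1, and `ι a` is not
      -- among these j + 1 values.
      no-short-cycle : pow f (suc j) a ≡ a → pow f k a ≢ ι a
      no-short-cycle cycle root = absurd (k % suc j) (s≤s⁻¹ (m%n<n k (suc j)))
        (trans (sym (pow-cycle f {d = j} cycle k)) root)
        where
        absurd : ∀ r → r ≤ j → pow f r a ≢ ι a
        absurd zero    _   = a≢ιa
        absurd (suc r) r≤j = proj₂ (apart (suc r) (s≤s z≤n) r≤j)

    -- A root commutes with `ι`, so the value at `e` dictates the one at `ι e`; both are set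
    -- together to keep the partial map equivariant.
    _⟨_↦_⟩ : (Fin n → Fin n) → Fin n → Fin n → Fin n → Fin n
    (g ⟨ e ↦ y ⟩) z with z Fin.≟ e | z Fin.≟ ι e
    ... | yes _ | _     = y
    ... | no _  | yes _ = ι y
    ... | no _  | no _  = g z

    module _ (g : Fin n → Fin n) (e y : Fin n) where

      upd-at : (g ⟨ e ↦ y ⟩) e ≡ y
      upd-at with e Fin.≟ e | e Fin.≟ ι e
      ... | yes _  | _ = refl
      ... | no e≢e | _ = contradiction refl e≢e

      upd-at-ι : ι e ≢ e → (g ⟨ e ↦ y ⟩) (ι e) ≡ ι y
      upd-at-ι ιe≢e with ι e Fin.≟ e | ι e Fin.≟ ι e
      ... | yes ιe≡e | _        = contradiction ιe≡e ιe≢e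
      ... | no _     | yes _    = refl
      ... | no _     | no ιe≢ιe = contradiction refl ιe≢ιe

      upd-away : ∀ {z} → z ≢ e → z ≢ ι e → (g ⟨ e ↦ y ⟩) z ≡ g z
      upd-away {z} z≢e z≢ιe with z Fin.≟ e | z Fin.≟ ι e
      ... | yes z≡e | _        = contradiction z≡e z≢e
      ... | no _    | yes z≡ιe = contradiction z≡ιe z≢ιe
      ... | no _    | no _     = refl

    -- Partial roots and the tables that extend them.

    _∪pair_ : Pred (Fin n) 0ℓ → Fin n → Pred (Fin n) 0ℓ
    (A ∪pair e) z = A z ⊎ z ≡ e ⊎ z ≡ ι e

    _∪pair?_ : {A : Pred (Fin n) 0ℓ} → Decidable A → (e : Fin n) → Decidable (A ∪pair e)
    (A? ∪pair? e) z = A? z ⊎-dec (z Fin.≟ e ⊎-dec z Fin.≟ ι e)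

    -- Outside `A` the values of `g` are arbitrary, so iterates of `g` say nothing; iterates of a
    -- compatible `f` do. Only equivariance is asked of `f`, not the root equation, because for the
    -- completed map that equation is what has to be derived.
    Compatible : Pred (Fin n) 0ℓ → (g f : Fin n → Fin n) → Set
    Compatible A g f = Equivariant f × (∀ z → A z → f z ≡ g z)

    RootExtending : Pred (Fin n) 0ℓ → (Fin n → Fin n) → Vec (Fin n) n → Set
    RootExtending A g v = Root (lookup v) × (∀ z → A z → lookup v z ≡ g z)

    rootExtending? : {A : Pred (Fin n) 0ℓ} → Decidable A → ∀ g → Decidable (RootExtending A g)
    rootExtending? A? g v =
      Fin.all? (λ i → pow (lookup v) k i Fin.≟ ι i)
      ×-dec Fin.all? (λ z → A? z →-dec (lookup v z Fin.≟ g z))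

    compatible : ∀ {A g} v → RootExtending A g v → Compatible A g (lookup v)
    compatible v (root , agree) = root-equivariant root , agree

    extensions : {A : Pred (Fin n) 0ℓ} → Decidable A → (Fin n → Fin n) → ℕ
    extensions A? g = ∑ (allVecs n n) (λ v → ⟦ rootExtending? A? g v ⟧)

    -- A is the set of points at which the partial root g is already determined.
    record Partial (A : Pred (Fin n) 0ℓ) (g : Fin n → Fin n) : Set where
      field
        stable      : ∀ {z} → A z → A (ι z)
        moves       : ∀ {z} → ¬ A z → ι z ≢ z
        equivariant : ∀ {z} → A z → g (ι z) ≡ ι (g z)

    -- The field `onto` gives every determined point a determined preimage. Together with
    -- injectivity this later prevents a new orbit from running into a finished one.
    record Closed (A : Pred (Fin n) 0ℓ) (g : Fin n → Fin n) : Set where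
      field
        isPartial : Partial A g
        root : ∀ {f} → Compatible A g f → ∀ {z} → A z → pow f k z ≡ ι z
        onto : ∀ {z} → A z → ∃ λ z′ → A z′ × g z′ ≡ z
      open Partial isPartial public

    -- Besides complete orbits there is one open orbit a ↦ ⋯ ↦ e with j steps, together with its
    -- mirror image under ι; the value at e is not yet determined.
    record Open (A : Pred (Fin n) 0ℓ) (g : Fin n → Fin n) (a e : Fin n) (j : ℕ) : Set where
      field
        isPartial : Partial A g
        a∈      : (A ∪pair e) a
        a≢ιa    : a ≢ ι a
        e∉      : ¬ A e
        reaches : ∀ {f} → Compatible A g f → pow f j a ≡ e
        root    : ∀ {f} → Compatible A g f → ∀ {z} → (A ∪pair e) z →
                  pow f k z ≡ ι z ⊎ ∃ (λ i → z ≡ pow f i a ⊎ z ≡ ι (pow f i a))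
        onto    : ∀ {z} → (A ∪pair e) z → z ≢ a → z ≢ ι a → ∃ λ z′ → A z′ × g z′ ≡ z
        apart   : ∀ {f} → Compatible A g f → ∀ r → 0 < r → r ≤ j → pow f r a ≢ a × pow f r a ≢ ι a
      open Partial isPartial public

    open-orbit : ∀ {A g a} → Closed A g → ¬ A a → Open A g a a 0
    open-orbit {A} {g} {a} closed a∉ = record
      { isPartial = isPartial
      ; a∈      = inj₂ (inj₁ refl)
      ; a≢ιa    = moves a∉ ∘ sym
      ; e∉      = a∉
      ; reaches = λ _ → refl
      ; root    = λ where
          compat (inj₁ z∈)        → inj₁ (root compat z∈)
          compat (inj₂ (inj₁ z≡)) → inj₂ (0 , inj₁ z≡)
          compat (inj₂ (inj₂ z≡)) → inj₂ (0 , inj₂ z≡)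
      ; onto    = λ where
          (inj₁ z∈)        _   _    → onto z∈
          (inj₂ (inj₁ z≡)) z≢a _    → contradiction z≡ z≢a
          (inj₂ (inj₂ z≡)) _   z≢ιa → contradiction z≡ z≢ιa
      ; apart   = λ { _ (suc _) _ () }
      }
      where open Closed closed

    module _ {A g} (p : Partial A g) {e : Fin n} (e∉ : ¬ A e) where

      open Partial p

      ιe∉ : ¬ A (ι e)
      ιe∉ ιe∈ = e∉ (subst A (ι-involutive e) (stable ιe∈))

      upd-on : ∀ y {z} → A z → (g ⟨ e ↦ y ⟩) z ≡ g z
      upd-on y z∈ = upd-away g e y (λ { refl → e∉ z∈ }) (λ { refl → ιe∉ z∈ })

      ∪pair-stable : ∀ {z} → (A ∪pair e) z → (A ∪pair e) (ι z)
      ∪pair-stable (inj₁ z∈)          = inj₁ (stable z∈)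
      ∪pair-stable (inj₂ (inj₁ refl)) = inj₂ (inj₂ refl)
      ∪pair-stable (inj₂ (inj₂ refl)) = inj₂ (inj₁ (ι-involutive e))

      upd-partial : ∀ y → Partial (A ∪pair e) (g ⟨ e ↦ y ⟩)
      upd-partial y = record
        { stable      = ∪pair-stable
        ; moves       = λ z∉ → moves (z∉ ∘ inj₁)
        ; equivariant = λ where
            (inj₁ z∈)          → trans (upd-on y (stable z∈)) (trans (equivariant z∈) (cong ι (sym (upd-on y z∈))))
            (inj₂ (inj₁ refl)) → trans (upd-at-ι g e y (moves e∉)) (cong ι (sym (upd-at g e y)))
            (inj₂ (inj₂ refl)) → begin
              (g ⟨ e ↦ y ⟩) (ι (ι e))   ≡⟨ cong (g ⟨ e ↦ y ⟩) (ι-involutive e) ⟩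
              (g ⟨ e ↦ y ⟩) e           ≡⟨ upd-at g e y ⟩
              y                         ≡⟨ ι-involutive y ⟨
              ι (ι y)                   ≡⟨ cong ι (upd-at-ι g e y (moves e∉)) ⟨
              ι ((g ⟨ e ↦ y ⟩) (ι e))   ∎
        }

      compatible-restrict : ∀ {y f} → Compatible (A ∪pair e) (g ⟨ e ↦ y ⟩) f → Compatible A g f
      compatible-restrict {y} (equi , agree) = equi , λ z z∈ → trans (agree z (inj₁ z∈)) (upd-on y z∈)

      compatible-at : ∀ {y f} → Compatible (A ∪pair e) (g ⟨ e ↦ y ⟩) f → f e ≡ y
      compatible-at {y} (_ , agree) = trans (agree e (inj₂ (inj₁ refl))) (upd-at g e y)

      -- Each table has exactly one value at `e`, and for a root equivariance makes its value at
      -- `ι e` the one prescribed by the update.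
      extensions-split : (A? : Decidable A) →
        extensions A? g ≡ ∑ (allFin n) (λ y → extensions (A? ∪pair? e) (g ⟨ e ↦ y ⟩))
      extensions-split A? = begin
        ∑ (allVecs n n) (λ v → ⟦ rootExtending? A? g v ⟧)
          ≡⟨ ∑-cong (allVecs n n) expand ⟩
        ∑ (allVecs n n) (λ v → ∑ (allFin n) (λ y → ⟦ rootExtending? (A? ∪pair? e) (g ⟨ e ↦ y ⟩) v ⟧))
          ≡⟨ ∑-swap (allVecs n n) (allFin n) _ ⟩
        ∑ (allFin n) (λ y → extensions (A? ∪pair? e) (g ⟨ e ↦ y ⟩)) ∎
        where
        refine : ∀ v y → RootExtending A g v × y ≡ lookup v e → RootExtending (A ∪pair e) (g ⟨ e ↦ y ⟩) v
        refine v y ((rt , agree) , refl) = rt , λ where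
          z (inj₁ z∈)          → trans (agree z z∈) (sym (upd-on y z∈))
          z (inj₂ (inj₁ refl)) → sym (upd-at g e y)
          z (inj₂ (inj₂ refl)) → trans (root-equivariant rt e) (sym (upd-at-ι g e y (moves e∉)))

        coarsen : ∀ v y → RootExtending (A ∪pair e) (g ⟨ e ↦ y ⟩) v → RootExtending A g v × y ≡ lookup v e
        coarsen v y ext@(rt , _) =
          (rt , proj₂ (compatible-restrict (compatible v ext))) , sym (compatible-at (compatible v ext))

        expand : ∀ v → ⟦ rootExtending? A? g v ⟧ ≡
                       ∑ (allFin n) (λ y → ⟦ rootExtending? (A? ∪pair? e) (g ⟨ e ↦ y ⟩) v ⟧)
        expand v = begin
          ⟦ ext? ⟧
            ≡⟨ ℕ.*-identityʳ _ ⟨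
          ⟦ ext? ⟧ * 1
            ≡⟨ cong (⟦ ext? ⟧ *_) (∑-allFin-≟ (lookup v e)) ⟨
          ⟦ ext? ⟧ * ∑ (allFin n) (λ y → ⟦ y Fin.≟ lookup v e ⟧)
            ≡⟨ ∑-*ˡ ⟦ ext? ⟧ (allFin n) _ ⟨
          ∑ (allFin n) (λ y → ⟦ ext? ⟧ * ⟦ y Fin.≟ lookup v e ⟧)
            ≡⟨ ∑-cong (allFin n) (λ y → trans (sym (⟦⟧-× ext? (y Fin.≟ lookup v e)))
                 (⟦⟧-cong (refine v y) (coarsen v y) (ext? ×-dec (y Fin.≟ lookup v e))
                   (rootExtending? (A? ∪pair? e) (g ⟨ e ↦ y ⟩) v))) ⟩
          ∑ (allFin n) (λ y → ⟦ rootExtending? (A? ∪pair? e) (g ⟨ e ↦ y ⟩) v ⟧) ∎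
          where
          ext? : Dec (RootExtending A g v)
          ext? = rootExtending? A? g v

      #-∪pair : (A? : Decidable A) → # (¬? ∘ A?) ≡ suc (suc (# (¬? ∘ (A? ∪pair? e))))
      #-∪pair A? = trans (#-remove (¬? ∘ A?) e e∉)
        (cong suc (trans (#-remove B? (ι e) (ιe∉ , moves e∉))
          (cong suc (#-cong (λ z → B? z ×-dec ¬? (z Fin.≟ ι e)) (¬? ∘ (A? ∪pair? e))
            (λ { z ((z∉ , z≢e) , z≢ιe) →
              λ { (inj₁ z∈) → z∉ z∈ ; (inj₂ (inj₁ z≡)) → z≢e z≡ ; (inj₂ (inj₂ z≡)) → z≢ιe z≡ } })
            (λ z z∉ → (z∉ ∘ inj₁ , z∉ ∘ inj₂ ∘ inj₁) , z∉ ∘ inj₂ ∘ inj₂)))))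
        where
        B? : Decidable (λ z → ¬ A z × z ≢ e)
        B? z = ¬? (A? z) ×-dec ¬? (z Fin.≟ e)

    extensions-none : ∀ {A g} (A? : Decidable A) → (∀ v → ¬ RootExtending A g v) → extensions A? g ≡ 0
    extensions-none {g = g} A? none =
      trans (∑-cong (allVecs n n) (λ v → ⟦⟧-no (none v) (rootExtending? A? g v))) (∑-zero (allVecs n n))

    -- The next value along an open orbit.

    module _ {A g a e j} (path : Open A g a e j) where

      open Open path

      extend-orbit : ∀ {y} → ¬ (A ∪pair e) y → Open (A ∪pair e) (g ⟨ e ↦ y ⟩) a y (suc j)
      extend-orbit {y} y∉ = record
        { isPartial = upd-partial isPartial e∉ y
        ; a∈      = inj₁ a∈
        ; a≢ιa    = a≢ιa
        ; e∉      = y∉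
        ; reaches = reaches′
        ; root    = λ where
            compat (inj₁ z∈)          → root (compatible-restrict isPartial e∉ compat) z∈
            compat (inj₂ (inj₁ refl)) → inj₂ (suc j , inj₁ (sym (reaches′ compat)))
            compat (inj₂ (inj₂ refl)) → inj₂ (suc j , inj₂ (cong ι (sym (reaches′ compat))))
        ; onto    = λ where
            (inj₁ z∈) z≢a z≢ιa → lift (onto z∈ z≢a z≢ιa)
            (inj₂ (inj₁ refl)) _ _ → e , inj₂ (inj₁ refl) , upd-at g e y
            (inj₂ (inj₂ refl)) _ _ → ι e , inj₂ (inj₂ refl) , upd-at-ι g e y (moves e∉)
        ; apart   = apart′
        }
        where
        lift : ∀ {z} → ∃ (λ z′ → A z′ × g z′ ≡ z) → ∃ (λ z′ → (A ∪pair e) z′ × (g ⟨ e ↦ y ⟩) z′ ≡ z)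
        lift (z′ , z′∈ , eq) = z′ , inj₁ z′∈ , trans (upd-on isPartial e∉ y z′∈) eq
        reaches′ : ∀ {f} → Compatible (A ∪pair e) (g ⟨ e ↦ y ⟩) f → pow f (suc j) a ≡ y
        reaches′ {f} compat = trans (cong f (reaches (compatible-restrict isPartial e∉ compat)))
                                    (compatible-at isPartial e∉ compat)
        apart′ : ∀ {f} → Compatible (A ∪pair e) (g ⟨ e ↦ y ⟩) f →
                 ∀ r → 0 < r → r ≤ suc j → pow f r a ≢ a × pow f r a ≢ ι a
        apart′ compat r 0<r r≤1+j with ℕ.m≤n⇒m<n∨m≡n r≤1+j
        ... | inj₁ r<1+j = apart (compatible-restrict isPartial e∉ compat) r 0<r (s≤s⁻¹ r<1+j)
        -- The new point `y` is untouched, whereas `a` and `ι a` are already in use.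
        ... | inj₂ refl  =
          (λ eq → y∉ (subst (A ∪pair e) (trans (sym eq) (reaches′ compat)) a∈)) ,
          (λ eq → y∉ (subst (A ∪pair e) (trans (sym eq) (reaches′ compat)) (∪pair-stable isPartial e∉ a∈)))

      -- Now f^(j+1) a = ι a, and k is an odd multiple of j + 1, so f^k a = ι a. This spreads to the
      -- whole orbit and its mirror image because f^k commutes with the powers of f and with `ι`.
      close-orbit : D j → Closed (A ∪pair e) (g ⟨ e ↦ ι a ⟩)
      close-orbit d = record
        { isPartial = upd-partial isPartial e∉ (ι a)
        ; root      = root′
        ; onto      = onto′
        }
        where
        pow-a : ∀ {f} → Compatible (A ∪pair e) (g ⟨ e ↦ ι a ⟩) f → pow f k a ≡ ι a
        pow-a {f} compat with Equivalence.to (D⇔ j) d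
        ... | q , k≡ = trans (cong (λ s → pow f s a) k≡)
          (pow-odd-multiple (proj₁ compat) {d = suc j}
            (trans (cong f (reaches (compatible-restrict isPartial e∉ compat))) (compatible-at isPartial e∉ compat)) q)

        root′ : ∀ {f} → Compatible (A ∪pair e) (g ⟨ e ↦ ι a ⟩) f → ∀ {z} → (A ∪pair e) z → pow f k z ≡ ι z
        root′ {f} compat@(equi , _) z∈ with root (compatible-restrict isPartial e∉ compat) z∈
        ... | inj₁ eq = eq
        ... | inj₂ (i , inj₁ refl) = on-orbit i
          where
          on-orbit : ∀ i → pow f k (pow f i a) ≡ ι (pow f i a)
          on-orbit i = trans (pow-pow f k i a) (trans (cong (pow f i) (pow-a compat)) (pow-comm f ι equi i a))
        ... | inj₂ (i , inj₂ refl) = begin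
          pow f k (ι (pow f i a))   ≡⟨ pow-comm f ι equi k (pow f i a) ⟩
          ι (pow f k (pow f i a))   ≡⟨ cong ι (pow-pow f k i a) ⟩
          ι (pow f i (pow f k a))   ≡⟨ cong (ι ∘ pow f i) (pow-a compat) ⟩
          ι (pow f i (ι a))         ≡⟨ cong ι (pow-comm f ι equi i a) ⟩
          ι (ι (pow f i a))         ∎

        onto′ : ∀ {z} → (A ∪pair e) z → ∃ λ z′ → (A ∪pair e) z′ × (g ⟨ e ↦ ι a ⟩) z′ ≡ z
        onto′ {z} z∈ with z Fin.≟ a | z Fin.≟ ι a
        -- The orbit and its mirror image join into one cycle: `e` goes to `ι a` and `ι e` to `a`.
        -- These are the two preimages that the open orbit lacked.
        ... | yes refl | _        = ι e , inj₂ (inj₂ refl) , trans (upd-at-ι g e (ι a) (moves e∉)) (ι-involutive a)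
        ... | no _     | yes refl = e , inj₂ (inj₁ refl) , upd-at g e (ι a)
        ... | no z≢a   | no z≢ιa with onto z∈ z≢a z≢ιa
        ...   | z′ , z′∈ , eq = z′ , inj₁ z′∈ , trans (upd-on isPartial e∉ (ι a) z′∈) eq

      closing-length : ∀ v → RootExtending (A ∪pair e) (g ⟨ e ↦ ι a ⟩) v → D j
      closing-length v ext@(rt , _) =
        half-orbit-length (proj₁ compat) a≢ιa (apart compat)
          (trans (cong (lookup v) (reaches compat)) (compatible-at isPartial e∉ (compatible v ext))) (rt a)
        where
        compat : Compatible A g (lookup v)
        compat = compatible-restrict isPartial e∉ (compatible v ext)

      -- The value `a` would close a cycle that misses `ι a`. Any other used point already has a
      -- preimage in `A`, and injectivity would put `e` into `A`.
      no-other-value : ∀ {y} → (A ∪pair e) y → y ≢ ι a → ∀ v → ¬ RootExtending (A ∪pair e) (g ⟨ e ↦ y ⟩) v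
      no-other-value {y} y∈ y≢ιa v ext@(rt , _) with y Fin.≟ a
      ... | yes refl =
        no-short-cycle (proj₁ compat) a≢ιa (apart compat)
          (trans (cong (lookup v) (reaches compat)) (compatible-at isPartial e∉ (compatible v ext))) (rt a)
        where
        compat : Compatible A g (lookup v)
        compat = compatible-restrict isPartial e∉ (compatible v ext)
      ... | no y≢a with onto y∈ y≢a y≢ιa
      ...   | z′ , z′∈ , eq = e∉ (subst A (root-injective rt (begin
        lookup v z′   ≡⟨ proj₂ (compatible-restrict isPartial e∉ (compatible v ext)) z′ z′∈ ⟩
        g z′          ≡⟨ eq ⟩
        y             ≡⟨ compatible-at isPartial e∉ (compatible v ext) ⟨
        lookup v e    ∎)) z′∈)

      -- Of all values at `e` only `ι a`, which requires `D j`, and the untouched points contribute.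
      -- This is the recursion of `R` with the two counts still abstract.
      extensions-step : (A? : Decidable A) (q r : ℕ) →
        (D j → extensions (A? ∪pair? e) (g ⟨ e ↦ ι a ⟩) ≡ q) →
        (∀ y → ¬ (A ∪pair e) y → extensions (A? ∪pair? e) (g ⟨ e ↦ y ⟩) ≡ r) →
        extensions A? g ≡ χ j * q + # (¬? ∘ (A? ∪pair? e)) * r
      extensions-step A? q r closes extends = begin
        extensions A? g
          ≡⟨ extensions-split isPartial e∉ A? ⟩
        ∑ (allFin n) (λ y → extensions B? (g ⟨ e ↦ y ⟩))
          ≡⟨ ∑-cong (allFin n) value ⟩
        ∑ (allFin n) (λ y → ⟦ y Fin.≟ ι a ⟧ * (χ j * q) + ⟦ ¬? (B? y) ⟧ * r)
          ≡⟨ ∑-+ (allFin n) _ _ ⟩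
        ∑ (allFin n) (λ y → ⟦ y Fin.≟ ι a ⟧ * (χ j * q)) + ∑ (allFin n) (λ y → ⟦ ¬? (B? y) ⟧ * r)
          ≡⟨ cong₂ _+_ (∑-*ʳ (χ j * q) (allFin n) _) (∑-*ʳ r (allFin n) _) ⟩
        ∑ (allFin n) (λ y → ⟦ y Fin.≟ ι a ⟧) * (χ j * q) + # (¬? ∘ B?) * r
          ≡⟨ cong (λ s → s * (χ j * q) + # (¬? ∘ B?) * r) (∑-allFin-≟ (ι a)) ⟩
        1 * (χ j * q) + # (¬? ∘ B?) * r
          ≡⟨ cong (_+ # (¬? ∘ B?) * r) (ℕ.*-identityˡ (χ j * q)) ⟩
        χ j * q + # (¬? ∘ B?) * r ∎
        where
        B? : Decidable (A ∪pair e)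
        B? = A? ∪pair? e

        closing : extensions B? (g ⟨ e ↦ ι a ⟩) ≡ χ j * q
        closing with D? j
        ... | yes d = trans (closes d) (sym (ℕ.+-identityʳ q))
        ... | no ¬d = extensions-none B? (λ v ext → ¬d (closing-length v ext))

        value : ∀ y → extensions B? (g ⟨ e ↦ y ⟩) ≡ ⟦ y Fin.≟ ι a ⟧ * (χ j * q) + ⟦ ¬? (B? y) ⟧ * r
        value y with y Fin.≟ ι a | B? y
        ... | yes refl | no ιa∉ = contradiction (∪pair-stable isPartial e∉ a∈) ιa∉
        ... | yes refl | yes _  = trans closing (sym (trans (ℕ.+-identityʳ _) (ℕ.+-identityʳ _)))
        ... | no _     | no y∉  = trans (extends y y∉) (sym (ℕ.+-identityʳ r))
        ... | no y≢ιa  | yes y∈ = extensions-none B? (no-other-value y∈ y≢ιa)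

    -- Once everything is determined, the map is compatible with itself, so the field `root` applies
    -- to it, and its own table is the only candidate.
    extensions-total : ∀ {A g} (A? : Decidable A) → Closed A g → (∀ z → A z) → extensions A? g ≡ 1
    extensions-total {A} {g} A? closed total = trans
      (∑-cong (allVecs n n) (λ v → ⟦⟧-cong (unique v) exists (rootExtending? A? g v) (Vec.≡-dec Fin._≟_ v (tabulate g))))
      (∑-allVecs-≟ (tabulate g))
      where
      open Closed closed
      g′ : Fin n → Fin n
      g′ = lookup (tabulate g)
      g′≗g : ∀ z → g′ z ≡ g z
      g′≗g = Vec.lookup∘tabulate g
      unique : ∀ v → RootExtending A g v → v ≡ tabulate g
      unique v (_ , agree) = trans (sym (Vec.tabulate∘lookup v)) (Vec.tabulate-cong (λ z → agree z (total z)))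
      exists : ∀ {v} → v ≡ tabulate g → RootExtending A g v
      exists refl = (λ i → root ((λ z → trans (g′≗g (ι z)) (trans (equivariant (total z)) (cong ι (sym (g′≗g z)))))
                              , λ z _ → g′≗g z) (total i))
                  , λ z _ → g′≗g z

    -- Induction on the number of untouched pairs.

    mutual

      extensions-closed : ∀ u {A g} (A? : Decidable A) → Closed A g → # (¬? ∘ A?) ≡ u * 2 → extensions A? g ≡ Q χ u
      extensions-closed zero    A? closed eq =
        extensions-total A? closed (λ z → decidable-stable (A? z) (#≡0⇒¬ (¬? ∘ A?) eq z))
      extensions-closed (suc u) A? closed eq with Fin.any? (¬? ∘ A?)
      ... | yes (a , a∉) = extensions-open u A? (open-orbit closed a∉)
        (ℕ.suc-injective (ℕ.suc-injective (trans (sym (#-∪pair (Closed.isPartial closed) a∉ A?)) eq)))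
      ... | no none = contradiction (trans (sym (#≡0 (¬? ∘ A?) (λ x x∉ → none (x , x∉)))) eq) (λ ())

      extensions-open : ∀ u {A g a e j} (A? : Decidable A) → Open A g a e j →
                        # (¬? ∘ (A? ∪pair? e)) ≡ u * 2 → extensions A? g ≡ R χ u j
      extensions-open zero {g = g} {a} {e} {j} A? path eq = begin
        extensions A? g
          -- The 1 is `Q χ 0`. With no untouched point left the second branch is empty, so its count
          -- may be given the default 0.
          ≡⟨ extensions-step path A? 1 0
               (λ d → extensions-closed zero (A? ∪pair? e) (close-orbit path d) eq)
               (λ y y∉ → contradiction y∉ (#≡0⇒¬ (¬? ∘ (A? ∪pair? e)) eq y)) ⟩
        χ j * 1 + # (¬? ∘ (A? ∪pair? e)) * 0
          ≡⟨ cong (χ j * 1 +_) (ℕ.*-zeroʳ (# (¬? ∘ (A? ∪pair? e)))) ⟩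
        χ j * 1 + 0
          ≡⟨ ℕ.+-identityʳ _ ⟩
        χ j * 1 ∎
      extensions-open (suc u) {g = g} {a} {e} {j} A? path eq = begin
        extensions A? g
          ≡⟨ extensions-step path A? (Q χ (suc u)) (R χ u (suc j))
               (λ d → extensions-closed (suc u) (A? ∪pair? e) (close-orbit path d) eq)
               (λ y y∉ → extensions-open u (A? ∪pair? e) (extend-orbit path y∉)
                 (ℕ.suc-injective (ℕ.suc-injective
                   (trans (sym (#-∪pair (upd-partial (Open.isPartial path) (Open.e∉ path) y) y∉ (A? ∪pair? e))) eq)))) ⟩
        χ j * Q χ (suc u) + # (¬? ∘ (A? ∪pair? e)) * R χ u (suc j)
          ≡⟨ cong (λ s → χ j * Q χ (suc u) + s * R χ u (suc j)) eq ⟩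
        χ j * Q χ (suc u) + suc u * 2 * R χ u (suc j) ∎

    Fixed? : Decidable (λ z → ι z ≡ z)
    Fixed? z = ι z Fin.≟ z

    -- The starting state: the points that form no pair {z, ι z} are settled beforehand, each mapped
    -- to itself.
    initial : Closed (λ z → ι z ≡ z) id
    initial = record
      { isPartial = record { stable = cong ι ; moves = id ; equivariant = λ _ → refl }
      ; root = λ compat fixed → trans (iterate compat fixed k) (sym fixed)
      ; onto = λ {z} fixed → z , fixed , refl
      }
      where
      iterate : ∀ {f} → Compatible (λ z → ι z ≡ z) id f → ∀ {z} → ι z ≡ z → ∀ m → pow f m z ≡ z
      iterate         _              _     zero    = refl
      iterate {f} compat@(_ , agree) fixed (suc m) = trans (cong f (iterate compat fixed m)) (agree _ fixed)

    -- A root maps fixed points of `ι` to fixed points. If there is at most one, the root fixes it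
    -- and hence extends `initial`.
    count-roots : (∀ {y z} → ι y ≡ y → ι z ≡ z → y ≡ z) → ∀ u → # (¬? ∘ Fixed?) ≡ u * 2 →
                  ∑ (allVecs n n) (λ v → ⟦ Fin.all? (λ i → pow (lookup v) k i Fin.≟ ι i) ⟧) ≡ Q χ u
    count-roots unique u eq = trans
      (∑-cong (allVecs n n) (λ v → ⟦⟧-cong (λ rt → rt , λ z fixed → unique (fixed-image v rt fixed) fixed) proj₁
        (Fin.all? (λ i → pow (lookup v) k i Fin.≟ ι i)) (rootExtending? Fixed? id v)))
      (extensions-closed u Fixed? initial eq)
      where
      fixed-image : ∀ v → Root (lookup v) → ∀ {z} → ι z ≡ z → ι (lookup v z) ≡ lookup v z
      fixed-image v rt {z} fixed = trans (sym (root-equivariant rt z)) (cong (lookup v) fixed)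

-- The 2-adic valuation and odd cofactors.

module Valuation where

  open import Data.Nat.Base using (_+_; _*_; s≤s⁻¹)
  open import Data.Nat.Solver using (module +-*-Solver)
  open RootCounting using (even⊎odd)

  even≢odd : ∀ x y → x * 2 ≢ suc (y * 2)
  even≢odd (suc x) zero    ()
  even≢odd (suc x) (suc y) eq = even≢odd x y (ℕ.suc-injective (ℕ.suc-injective eq))

  v2aux-odd : ∀ f h → v2aux f (suc (h * 2)) ≡ 0
  v2aux-odd zero    h = refl
  v2aux-odd (suc f) h rewrite [m+kn]%n≡m%n 1 h 2 {{_}} = refl

  v2aux-double : ∀ f h → v2aux (suc f) (suc h * 2) ≡ suc (v2aux f (suc h))
  v2aux-double f h rewrite m*n%n≡0 (suc h) 2 {{_}} | m*n/n≡m (suc h) 2 {{_}} = refl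

  v2aux-decompose : ∀ f n → 0 < n → n ≤ f → ∃ λ h → n ≡ 2 ^ v2aux f n * suc (h * 2)
  v2aux-decompose zero    zero () _
  v2aux-decompose (suc f) n 0<n n≤f with even⊎odd n
  ... | inj₂ (h , refl) = h , sym (trans (cong (λ e → 2 ^ e * suc (h * 2)) (v2aux-odd (suc f) h)) (ℕ.+-identityʳ _))
  -- From suc h * 2 ≤ suc f follows suc h ≤ f: one unit of fuel pays for one halving.
  v2aux-decompose (suc f) _ 0<n n≤f | inj₁ (suc h , refl)
    with v2aux-decompose f (suc h) (s≤s z≤n) (ℕ.≤-trans (s≤s (ℕ.m≤m*n h 2)) (s≤s⁻¹ n≤f))
  ... | h′ , eq = h′ , (begin
    suc h * 2                                          ≡⟨ cong (_* 2) eq ⟩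
    2 ^ v2aux f (suc h) * suc (h′ * 2) * 2
      ≡⟨ solve 2 (λ x y → x :* y :* con 2 := con 2 :* x :* y) refl (2 ^ v2aux f (suc h)) (suc (h′ * 2)) ⟩
    2 ^ suc (v2aux f (suc h)) * suc (h′ * 2)
      ≡⟨ cong (λ e → 2 ^ e * suc (h′ * 2)) (v2aux-double f h) ⟨
    2 ^ v2aux (suc f) (suc h * 2) * suc (h′ * 2)       ∎)
    where
    open ≡-Reasoning
    open +-*-Solver

  v2-decompose : ∀ n → 0 < n → ∃ λ h → n ≡ 2 ^ v2 n * suc (h * 2)
  v2-decompose n 0<n = v2aux-decompose n n 0<n ℕ.≤-refl

  -- Common factors 2 are cancelled until one side is odd; a remaining factor 2 on the other side
  -- would contradict parity.
  exponent-unique : ∀ e e′ h h′ → 2 ^ e * suc (h * 2) ≡ 2 ^ e′ * suc (h′ * 2) → e ≡ e′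
  exponent-unique zero    zero     h h′ eq = refl
  exponent-unique zero    (suc e′) h h′ eq = contradiction
    (trans (solve 2 (λ x y → x :* y :* con 2 := con 2 :* x :* y) refl (2 ^ e′) (suc (h′ * 2))) (trans (sym eq) (ℕ.+-identityʳ _)))
    (even≢odd (2 ^ e′ * suc (h′ * 2)) h)
    where open +-*-Solver
  exponent-unique (suc e) zero     h h′ eq = sym (exponent-unique zero (suc e) h′ h (sym eq))
  exponent-unique (suc e) (suc e′) h h′ eq = cong suc (exponent-unique e e′ h h′
    (ℕ.*-cancelˡ-≡ _ _ 2 (trans (sym (ℕ.*-assoc 2 (2 ^ e) _)) (trans eq (ℕ.*-assoc 2 (2 ^ e′) _)))))

  v2-unique : ∀ n e h → 0 < n → n ≡ 2 ^ e * suc (h * 2) → v2 n ≡ e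
  v2-unique n e h 0<n eq with v2-decompose n 0<n
  ... | h′ , eq′ = exponent-unique (v2 n) e h′ h (trans (sym eq′) eq)

  v2-odd-multiple : ∀ h d → 0 < d → v2 (suc (h * 2) * d) ≡ v2 d
  v2-odd-multiple h d@(suc _) 0<d with v2-decompose d 0<d
  -- The third argument comes from (2h+1)(2h′+1) = 2(h(2h′+1) + h′) + 1.
  ... | h′ , eq = v2-unique (suc (h * 2) * d) (v2 d) (h * suc (h′ * 2) + h′) (s≤s z≤n)
    (trans (cong (suc (h * 2) *_) eq)
      (solve 3 (λ x h h′ → (con 1 :+ h :* con 2) :* (x :* (con 1 :+ h′ :* con 2))
                        := x :* (con 1 :+ (h :* (con 1 :+ h′ :* con 2) :+ h′) :* con 2)) refl (2 ^ v2 d) h h′))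
    where open +-*-Solver

  -- The left valuation is 1 + v2 h + v2 d, which exceeds v2 d.
  v2-even-multiple : ∀ h d → 0 < h → 0 < d → v2 (h * 2 * d) ≢ v2 d
  v2-even-multiple h@(suc _) d@(suc _) 0<h 0<d v2≡ with v2-decompose h 0<h | v2-decompose d 0<d
  ... | x , h≡ | y , d≡ = ℕ.m≢1+n+m (v2 d) (trans (sym v2≡)
    (v2-unique (h * 2 * d) (suc (v2 h + v2 d)) (x * suc (y * 2) + y) (s≤s z≤n) (begin
      h * 2 * d
        ≡⟨ cong₂ (λ s t → s * 2 * t) h≡ d≡ ⟩
      2 ^ v2 h * suc (x * 2) * 2 * (2 ^ v2 d * suc (y * 2))
        ≡⟨ solve 4 (λ a b x y → a :* (con 1 :+ x :* con 2) :* con 2 :* (b :* (con 1 :+ y :* con 2))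
                             := con 2 :* (a :* b) :* (con 1 :+ (x :* (con 1 :+ y :* con 2) :+ y) :* con 2))
             refl (2 ^ v2 h) (2 ^ v2 d) x y ⟩
      2 * (2 ^ v2 h * 2 ^ v2 d) * suc ((x * suc (y * 2) + y) * 2)
        ≡⟨ cong (λ s → 2 * s * suc ((x * suc (y * 2) + y) * 2)) (ℕ.^-distribˡ-+-* 2 (v2 h) (v2 d)) ⟨
      2 ^ suc (v2 h + v2 d) * suc ((x * suc (y * 2) + y) * 2) ∎)))
    where
    open ≡-Reasoning
    open +-*-Solver

  -- The valuation of k exceeds that of a divisor exactly when the cofactor is even. This links the
  -- divisors of the theorem to the predicate `D` of the orbit analysis.
  odd-quotient⇔ : ∀ {k} → 0 < k → ∀ j →
                  (suc j ∣ k × v2 (suc j) ≡ v2 k) ⇔ ∃ (λ q → k ≡ suc (q * 2) * suc j)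
  odd-quotient⇔ {k} 0<k j = mk⇔ to from
    where
    to : suc j ∣ k × v2 (suc j) ≡ v2 k → ∃ (λ q → k ≡ suc (q * 2) * suc j)
    to (divides q refl , v2≡) with even⊎odd q
    ... | inj₂ (h , refl)     = h , refl
    ... | inj₁ (zero , refl)  = contradiction 0<k λ ()
    ... | inj₁ (suc h , refl) = contradiction (sym v2≡) (v2-even-multiple (suc h) (suc j) (s≤s z≤n) (s≤s z≤n))

    from : ∃ (λ q → k ≡ suc (q * 2) * suc j) → suc j ∣ k × v2 (suc j) ≡ v2 k
    from (q , refl) = divides (suc (q * 2)) refl , sym (v2-odd-multiple q (suc j) (s≤s z≤n))

open import Data.Integer using (+_)
open import Data.Rational using (_/_)
open import Data.Rational.Base using (ℚ; 0ℚ; 1ℚ; _+_; _*_; toℚᵘ)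

module ∑ℚ = Summation (CommutativeRing.commutativeSemiring ℚ.+-*-commutativeRing)

-- The generating function of the formula.

module ExponentialFormula where

  open RootCounting using (Q; R)

  cast : ℕ → ℚ
  cast n = + n / 1

  -- Normalised fractions with variable entries do not compute. Identities are therefore moved to
  -- unnormalised ones, where they become cross multiplications.
  toℚᵘ-cast : ∀ n → toℚᵘ (cast n) ≃ mkℚᵘ (+ n) 0
  toℚᵘ-cast n = ℚ.toℚᵘ-fromℚᵘ (mkℚᵘ (+ n) 0)

  cast-+ : ∀ m n → cast (m ℕ.+ n) ≡ cast m + cast n
  cast-+ m n = ℚ.toℚᵘ-injective (begin
    toℚᵘ (cast (m ℕ.+ n))                       ≈⟨ toℚᵘ-cast (m ℕ.+ n) ⟩
    mkℚᵘ (+ (m ℕ.+ n)) 0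
      ≈⟨ *≡* (cong (ℤ._* + 1) (sym (cong₂ ℤ._+_ (ℤ.*-identityʳ (+ m)) (ℤ.*-identityʳ (+ n))))) ⟩
    mkℚᵘ (+ m) 0 ℚᵘ.+ mkℚᵘ (+ n) 0              ≈⟨ ℚᵘ.+-cong (toℚᵘ-cast m) (toℚᵘ-cast n) ⟨
    toℚᵘ (cast m) ℚᵘ.+ toℚᵘ (cast n)            ≈⟨ ℚ.toℚᵘ-homo-+ (cast m) (cast n) ⟨
    toℚᵘ (cast m + cast n)                      ∎)
    where open import Relation.Binary.Reasoning.Setoid ℚᵘ.≃-setoid

  cast-*-/ : ∀ m u v .{{_ : NonZero v}} → toℚᵘ (cast m * (+ u / v)) ≃ (+ (m ℕ.* u)) ℚᵘ./ v
  cast-*-/ m u (suc v) = begin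
    toℚᵘ (cast m * (+ u / suc v))               ≈⟨ ℚ.toℚᵘ-homo-* (cast m) (+ u / suc v) ⟩
    toℚᵘ (cast m) ℚᵘ.* toℚᵘ (+ u / suc v)       ≈⟨ ℚᵘ.*-cong (toℚᵘ-cast m) (ℚ.toℚᵘ-fromℚᵘ (mkℚᵘ (+ u) v)) ⟩
    mkℚᵘ (+ m) 0 ℚᵘ.* mkℚᵘ (+ u) v
      ≈⟨ *≡* (cong₂ ℤ._*_ (sym (ℤ.pos-* m u)) (cong (λ s → + suc s) (sym (ℕ.+-identityʳ v)))) ⟩
    mkℚᵘ (+ (m ℕ.* u)) v                        ∎
    where open import Relation.Binary.Reasoning.Setoid ℚᵘ.≃-setoid

  cast-* : ∀ m n → cast (m ℕ.* n) ≡ cast m * cast n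
  cast-* m n = ℚ.toℚᵘ-injective (ℚᵘ.≃-trans (toℚᵘ-cast (m ℕ.* n)) (ℚᵘ.≃-sym (cast-*-/ m n 1)))

  cast-*-/-cong : ∀ m u v m′ u′ v′ .{{_ : NonZero v}} .{{_ : NonZero v′}} →
                  m ℕ.* u ℕ.* v′ ≡ m′ ℕ.* u′ ℕ.* v → cast m * (+ u / v) ≡ cast m′ * (+ u′ / v′)
  cast-*-/-cong m u v@(suc _) m′ u′ v′@(suc _) eq = ℚ.toℚᵘ-injective
    (ℚᵘ.≃-trans (cast-*-/ m u v) (ℚᵘ.≃-trans
      (*≡* (trans (sym (ℤ.pos-* (m ℕ.* u) v′)) (trans (cong +_ eq) (ℤ.pos-* (m′ ℕ.* u′) v))))
      (ℚᵘ.≃-sym (cast-*-/ m′ u′ v′))))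

  -- With d = p + 1, `factor p a` is the coefficient of x^(ad) in E = exp(2^p x^d / d). The identity
  -- is x E' = 2^p x^d E, read off coefficientwise.
  factor-suc : ∀ p a → cast (suc a ℕ.* suc p) * factor p (suc a) ≡ cast (2 ^ p) * factor p a
  factor-suc p a = cast-*-/-cong (suc a ℕ.* suc p) (2 ^ (suc a ℕ.* p)) (suc a ! ℕ.* suc p ^ suc a)
                                 (2 ^ p) (2 ^ (a ℕ.* p)) (a ! ℕ.* suc p ^ a)
    {{ℕ.m*n≢0 (suc a !) (suc p ^ suc a) {{suc a ℕ.!≢0}} {{ℕ.m^n≢0 (suc p) (suc a)}}}}
    {{ℕ.m*n≢0 (a !) (suc p ^ a) {{a ℕ.!≢0}} {{ℕ.m^n≢0 (suc p) a}}}}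
    (trans (cong (λ s → suc a ℕ.* suc p ℕ.* s ℕ.* (a ! ℕ.* suc p ^ a)) (ℕ.^-distribˡ-+-* 2 p (a ℕ.* p)))
      (solve 6 (λ a d x y f e → a :* d :* (x :* y) :* (f :* e) := x :* y :* (a :* f :* (d :* e))) refl
        (suc a) (suc p) (2 ^ p) (2 ^ (a ℕ.* p)) (a !) (suc p ^ a)))
    where open ℕ.+-*-Solver

  open ∑ℚ
  open ≡-Reasoning

  cast-∑ : {A : Set} (xs : List A) (f : A → ℕ) → cast (∑ℕ.∑ xs f) ≡ ∑ xs (cast ∘ f)
  cast-∑ []       f = refl
  cast-∑ (x ∷ xs) f = trans (cast-+ (f x) (∑ℕ.∑ xs f)) (cong (λ s → cast (f x) + s) (cast-∑ xs f))

  cast-⟦⟧ : {P : Set} (P? : Dec P) → cast ∑ℕ.⟦ P? ⟧ ≡ ⟦ P? ⟧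
  cast-⟦⟧ (yes _) = refl
  cast-⟦⟧ (no _)  = refl

  -- Multiplication of a power series by x^e, on coefficient sequences.
  shift : ℕ → (ℕ → ℚ) → ℕ → ℚ
  shift zero    H m       = H m
  shift (suc e) H zero    = 0ℚ
  shift (suc e) H (suc m) = shift e H m

  shift-cong : ∀ e {H H′} m → (∀ m′ → m′ ≤ m → H m′ ≡ H′ m′) → shift e H m ≡ shift e H′ m
  shift-cong zero    m       eq = eq m ℕ.≤-refl
  shift-cong (suc e) zero    eq = refl
  shift-cong (suc e) (suc m) eq = shift-cong e m (λ m′ m′≤m → eq m′ (ℕ.m≤n⇒m≤1+n m′≤m))

  shift-+ : ∀ e e′ H m → shift (e ℕ.+ e′) H m ≡ shift e (shift e′ H) m
  shift-+ zero    e′ H m       = refl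
  shift-+ (suc e) e′ H zero    = refl
  shift-+ (suc e) e′ H (suc m) = shift-+ e e′ H m

  shift-comm : ∀ e e′ H m → shift e (shift e′ H) m ≡ shift e′ (shift e H) m
  shift-comm e e′ H m =
    trans (sym (shift-+ e e′ H m)) (trans (cong (λ s → shift s H m) (ℕ.+-comm e e′)) (shift-+ e′ e H m))

  shift-low : ∀ e H m → m < e → shift e H m ≡ 0ℚ
  shift-low (suc e) H zero    _         = refl
  shift-low (suc e) H (suc m) (s≤s m<e) = shift-low e H m m<e

  shift-∑ : ∀ {A : Set} e (xs : List A) (c : A → ℚ) (H : A → ℕ → ℚ) m →
            shift e (λ m → ∑ xs (λ x → c x * H x m)) m ≡ ∑ xs (λ x → c x * shift e (H x) m)
  shift-∑ zero    xs c H m       = refl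
  shift-∑ (suc e) xs c H zero    = sym (trans (∑-cong xs (λ x → ℚ.*-zeroʳ (c x))) (∑-zero xs))
  shift-∑ (suc e) xs c H (suc m) = shift-∑ e xs c H m

  -- The Leibniz rule for the operator x d/dx applied to x^e H.
  shift-derivative : ∀ e H m → cast m * shift e H m ≡ shift e (λ m → cast m * H m) m + cast e * shift e H m
  shift-derivative zero    H m       = solve 2 (λ m x → m :* x := m :* x :+ con 0ℚ :* x) refl (cast m) (H m)
    where open ℚ.+-*-Solver
  shift-derivative (suc e) H zero    =
    trans (ℚ.*-zeroʳ (cast 0)) (sym (trans (ℚ.+-identityˡ _) (ℚ.*-zeroʳ (cast (suc e)))))
  shift-derivative (suc e) H (suc m) = begin
    cast (suc m) * x                ≡⟨ cong (_* x) (cast-+ 1 m) ⟩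
    (1ℚ + cast m) * x               ≡⟨ ℚ.*-distribʳ-+ x 1ℚ (cast m) ⟩
    1ℚ * x + cast m * x             ≡⟨ cong (λ s → 1ℚ * x + s) (shift-derivative e H m) ⟩
    1ℚ * x + (y + cast e * x)
      ≡⟨ solve 3 (λ x y e → con 1ℚ :* x :+ (y :+ e :* x) := y :+ (con 1ℚ :+ e) :* x) refl x y (cast e) ⟩
    y + (1ℚ + cast e) * x           ≡⟨ cong (λ s → y + s * x) (cast-+ 1 e) ⟨
    y + cast (suc e) * x            ∎
    where
    open ℚ.+-*-Solver
    x y : ℚ
    x = shift e H m
    y = shift e (λ m → cast m * H m) m

  -- The coefficient of x^m in ∏_p exp(2^p x^(p+1) / (p+1)), with exponents truncated at M ≥ m.
  coeff : List ℕ → ℕ → ℕ → ℚ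
  coeff ps M m = ∑ (tuples (length ps) M) (λ as → ⟦ weighted ps as ℕ.≟ m ⟧ * prodℚ (zipWith factor ps as))

  ∑-shift : ∀ {A : Set} e (xs : List A) (w : A → ℕ) (c : A → ℚ) m →
            ∑ xs (λ x → ⟦ e ℕ.+ w x ℕ.≟ m ⟧ * c x) ≡ shift e (λ m → ∑ xs (λ x → ⟦ w x ℕ.≟ m ⟧ * c x)) m
  ∑-shift zero    xs w c m       = refl
  ∑-shift (suc e) xs w c zero    = trans
    (∑-cong xs (λ x → trans (cong (_* c x) (⟦⟧-no (λ ()) (suc e ℕ.+ w x ℕ.≟ 0))) (ℚ.*-zeroˡ (c x)))) (∑-zero xs)
  ∑-shift (suc e) xs w c (suc m) = trans
    (∑-cong xs (λ x → cong (_* c x)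
      (⟦⟧-cong ℕ.suc-injective (cong suc) (suc (e ℕ.+ w x) ℕ.≟ suc m) (e ℕ.+ w x ℕ.≟ m))))
    (∑-shift e xs w c m)

  *-swap : ∀ x y z → x * (y * z) ≡ y * (x * z)
  *-swap = solve 3 (λ x y z → x :* (y :* z) := y :* (x :* z)) refl
    where open ℚ.+-*-Solver

  -- Sorting the tuples by their first entry multiplies the series of `ps` by the truncated
  -- exponential series for `p`.
  coeff-∷ : ∀ p ps M m →
    coeff (p ∷ ps) M m ≡ ∑ (upTo (suc M)) (λ a → factor p a * shift (a ℕ.* suc p) (coeff ps M) m)
  coeff-∷ p ps M m = trans
    (∑-cartesian _∷_ (upTo (suc M)) (tuples (length ps) M)
      (λ as → ⟦ weighted (p ∷ ps) as ℕ.≟ m ⟧ * prodℚ (zipWith factor (p ∷ ps) as)))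
    (∑-cong (upTo (suc M)) (λ a → begin
      ∑ ts (λ as → ⟦ a ℕ.* suc p ℕ.+ weighted ps as ℕ.≟ m ⟧ * (factor p a * P as))
        ≡⟨ ∑-cong ts (λ as → *-swap ⟦ a ℕ.* suc p ℕ.+ weighted ps as ℕ.≟ m ⟧ (factor p a) (P as)) ⟩
      ∑ ts (λ as → factor p a * (⟦ a ℕ.* suc p ℕ.+ weighted ps as ℕ.≟ m ⟧ * P as))
        ≡⟨ ∑-*ˡ (factor p a) ts (λ as → ⟦ a ℕ.* suc p ℕ.+ weighted ps as ℕ.≟ m ⟧ * P as) ⟩
      factor p a * ∑ ts (λ as → ⟦ a ℕ.* suc p ℕ.+ weighted ps as ℕ.≟ m ⟧ * P as)
        ≡⟨ cong (factor p a *_) (∑-shift (a ℕ.* suc p) ts (weighted ps) P m) ⟩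
      factor p a * shift (a ℕ.* suc p) (coeff ps M) m ∎))
    where
    ts : List (List ℕ)
    ts = tuples (length ps) M
    P : List ℕ → ℚ
    P as = prodℚ (zipWith factor ps as)

  shift-coeff-∷ : ∀ e p ps M m → shift e (coeff (p ∷ ps) M) m ≡
    ∑ (upTo (suc M)) (λ a → factor p a * shift e (shift (a ℕ.* suc p) (coeff ps M)) m)
  shift-coeff-∷ e p ps M m = trans (shift-cong e m (λ m′ _ → coeff-∷ p ps M m′))
    (shift-∑ e (upTo (suc M)) (factor p) (λ a → shift (a ℕ.* suc p) (coeff ps M)) m)

  coeff-0 : ∀ ps M → coeff ps M 0 ≡ 1ℚ
  coeff-0 []       M = refl
  coeff-0 (p ∷ ps) M = begin
    coeff (p ∷ ps) M 0
      ≡⟨ coeff-∷ p ps M 0 ⟩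
    ∑ (upTo (suc M)) (λ a → factor p a * shift (a ℕ.* suc p) (coeff ps M) 0)
      ≡⟨ ∑-upTo-suc (λ a → factor p a * shift (a ℕ.* suc p) (coeff ps M) 0) M ⟩
    1ℚ * coeff ps M 0 + ∑ (upTo M) (λ a → factor p (suc a) * 0ℚ)
      ≡⟨ cong₂ _+_ (trans (ℚ.*-identityˡ _) (coeff-0 ps M))
           (trans (∑-cong (upTo M) (λ a → ℚ.*-zeroʳ (factor p (suc a)))) (∑-zero (upTo M))) ⟩
    1ℚ ∎

  -- The logarithmic derivative x G' = G · ∑_p 2^p x^(p+1) of the exponential product.
  coeff-derivative : ∀ ps M m → m ≤ M →
    cast m * coeff ps M m ≡ ∑ ps (λ p → cast (2 ^ p) * shift (suc p) (coeff ps M) m)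
  coeff-derivative []       M zero    _ = refl
  coeff-derivative []       M (suc m) _ = ℚ.*-zeroʳ (cast (suc m))
  coeff-derivative (p ∷ ps) M m m≤M = begin
    cast m * coeff (p ∷ ps) M m
      ≡⟨ cong (cast m *_) (coeff-∷ p ps M m) ⟩
    cast m * ∑ (upTo (suc M)) (λ a → f a * shift (a ℕ.* d) H m)
      ≡⟨ ∑-*ˡ (cast m) (upTo (suc M)) _ ⟨
    ∑ (upTo (suc M)) (λ a → cast m * (f a * shift (a ℕ.* d) H m))
      ≡⟨ ∑-cong (upTo (suc M)) leibniz ⟩
    ∑ (upTo (suc M)) (λ a → f a * shift (a ℕ.* d) θH m + own a)
      ≡⟨ ∑-+ (upTo (suc M)) (λ a → f a * shift (a ℕ.* d) θH m) own ⟩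
    ∑ (upTo (suc M)) (λ a → f a * shift (a ℕ.* d) θH m) + ∑ (upTo (suc M)) own
      ≡⟨ cong₂ _+_ others owns ⟩
    ∑ ps (λ p′ → cast (2 ^ p′) * shift (suc p′) (coeff (p ∷ ps) M) m) + cast (2 ^ p) * shift d (coeff (p ∷ ps) M) m
      ≡⟨ ℚ.+-comm (∑ ps (λ p′ → cast (2 ^ p′) * shift (suc p′) (coeff (p ∷ ps) M) m)) _ ⟩
    ∑ (p ∷ ps) (λ p′ → cast (2 ^ p′) * shift (suc p′) (coeff (p ∷ ps) M) m) ∎
    where
    d : ℕ
    d = suc p
    f : ℕ → ℚ
    f = factor p
    H θH : ℕ → ℚ
    H = coeff ps M
    θH m = cast m * H m
    own : ℕ → ℚ
    own a = cast (a ℕ.* d) * f a * shift (a ℕ.* d) H m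

    leibniz : ∀ a → cast m * (f a * shift (a ℕ.* d) H m) ≡ f a * shift (a ℕ.* d) θH m + own a
    leibniz a = begin
      cast m * (f a * x)                      ≡⟨ *-swap (cast m) (f a) x ⟩
      f a * (cast m * x)                      ≡⟨ cong (f a *_) (shift-derivative (a ℕ.* d) H m) ⟩
      f a * (y + c * x)
        ≡⟨ solve 4 (λ f x y c → f :* (y :+ c :* x) := f :* y :+ c :* f :* x) refl (f a) x y c ⟩
      f a * y + c * f a * x                   ∎
      where
      open ℚ.+-*-Solver
      x y c : ℚ
      x = shift (a ℕ.* d) H m
      y = shift (a ℕ.* d) θH m
      c = cast (a ℕ.* d)

    -- The part of the product rule in which the derivative falls on the factors of `ps`: the
    -- induction hypothesis at degrees m′ ≤ m, with the same M, followed by an exchange of sums.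
    others : ∑ (upTo (suc M)) (λ a → f a * shift (a ℕ.* d) θH m) ≡
             ∑ ps (λ p′ → cast (2 ^ p′) * shift (suc p′) (coeff (p ∷ ps) M) m)
    others = begin
      ∑ (upTo (suc M)) (λ a → f a * shift (a ℕ.* d) θH m)
        ≡⟨ ∑-cong (upTo (suc M)) expand ⟩
      ∑ (upTo (suc M)) (λ a → ∑ ps (λ p′ → cast (2 ^ p′) * (f a * shift (suc p′) (shift (a ℕ.* d) H) m)))
        ≡⟨ ∑-swap (upTo (suc M)) ps _ ⟩
      ∑ ps (λ p′ → ∑ (upTo (suc M)) (λ a → cast (2 ^ p′) * (f a * shift (suc p′) (shift (a ℕ.* d) H) m)))
        ≡⟨ ∑-cong ps (λ p′ → trans (∑-*ˡ (cast (2 ^ p′)) (upTo (suc M)) _)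
             (cong (cast (2 ^ p′) *_) (sym (shift-coeff-∷ (suc p′) p ps M m)))) ⟩
      ∑ ps (λ p′ → cast (2 ^ p′) * shift (suc p′) (coeff (p ∷ ps) M) m) ∎
      where
      expand : ∀ a → f a * shift (a ℕ.* d) θH m ≡
                     ∑ ps (λ p′ → cast (2 ^ p′) * (f a * shift (suc p′) (shift (a ℕ.* d) H) m))
      expand a = begin
        f a * shift (a ℕ.* d) θH m
          ≡⟨ cong (f a *_) (shift-cong (a ℕ.* d) m
               (λ m′ m′≤m → coeff-derivative ps M m′ (ℕ.≤-trans m′≤m m≤M))) ⟩
        f a * shift (a ℕ.* d) (λ m → ∑ ps (λ p′ → cast (2 ^ p′) * shift (suc p′) H m)) m
          ≡⟨ cong (f a *_) (shift-∑ (a ℕ.* d) ps (λ p′ → cast (2 ^ p′)) (λ p′ → shift (suc p′) H) m) ⟩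
        f a * ∑ ps (λ p′ → cast (2 ^ p′) * shift (a ℕ.* d) (shift (suc p′) H) m)
          ≡⟨ ∑-*ˡ (f a) ps _ ⟨
        ∑ ps (λ p′ → f a * (cast (2 ^ p′) * shift (a ℕ.* d) (shift (suc p′) H) m))
          ≡⟨ ∑-cong ps (λ p′ → trans (*-swap (f a) (cast (2 ^ p′)) _)
               (cong (λ s → cast (2 ^ p′) * (f a * s)) (shift-comm (a ℕ.* d) (suc p′) H m))) ⟩
        ∑ ps (λ p′ → cast (2 ^ p′) * (f a * shift (suc p′) (shift (a ℕ.* d) H) m)) ∎

    -- The part in which the derivative falls on the factor of `p`. Its term a = 0 vanishes, and
    -- `factor-suc` lowers the others by one.
    owns : ∑ (upTo (suc M)) own ≡ cast (2 ^ p) * shift d (coeff (p ∷ ps) M) m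
    owns = begin
      ∑ (upTo (suc M)) own
        ≡⟨ ∑-upTo-suc own M ⟩
      own 0 + ∑ (upTo M) (own ∘ suc)
        ≡⟨ cong₂ _+_ (trans (cong (_* H m) (ℚ.*-zeroˡ (f 0))) (ℚ.*-zeroˡ (H m))) (∑-cong (upTo M) lower) ⟩
      0ℚ + ∑ (upTo M) (λ a → cast (2 ^ p) * g a)
        ≡⟨ ℚ.+-identityˡ _ ⟩
      ∑ (upTo M) (λ a → cast (2 ^ p) * g a)
        ≡⟨ ∑-*ˡ (cast (2 ^ p)) (upTo M) g ⟩
      cast (2 ^ p) * ∑ (upTo M) g
        ≡⟨ cong (cast (2 ^ p) *_) (ℚ.+-identityʳ (∑ (upTo M) g)) ⟨
      cast (2 ^ p) * (∑ (upTo M) g + 0ℚ)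
        ≡⟨ cong (λ s → cast (2 ^ p) * (∑ (upTo M) g + s)) last-vanishes ⟨
      cast (2 ^ p) * (∑ (upTo M) g + g M)
        ≡⟨ cong (cast (2 ^ p) *_) (∑-upTo-last g M) ⟨
      cast (2 ^ p) * ∑ (upTo (suc M)) g
        ≡⟨ cong (cast (2 ^ p) *_) (shift-coeff-∷ d p ps M m) ⟨
      cast (2 ^ p) * shift d (coeff (p ∷ ps) M) m ∎
      where
      g : ℕ → ℚ
      g a = f a * shift d (shift (a ℕ.* d) H) m

      lower : ∀ a → own (suc a) ≡ cast (2 ^ p) * g a
      lower a = begin
        cast (suc a ℕ.* d) * f (suc a) * shift (d ℕ.+ a ℕ.* d) H m
          ≡⟨ cong₂ _*_ (factor-suc p a) (shift-+ d (a ℕ.* d) H m) ⟩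
        cast (2 ^ p) * f a * shift d (shift (a ℕ.* d) H) m
          ≡⟨ ℚ.*-assoc (cast (2 ^ p)) (f a) _ ⟩
        cast (2 ^ p) * g a ∎

      -- Lowering the index leaves only a < M. The absent term a = M has degree at least (M + 1)d >
      -- M ≥ m and can be added back as zero.
      last-vanishes : g M ≡ 0ℚ
      last-vanishes = trans (cong (f M *_) (trans (sym (shift-+ d (M ℕ.* d) H m))
          (shift-low (d ℕ.+ M ℕ.* d) H m
            (ℕ.≤-<-trans m≤M (s≤s (ℕ.≤-trans (ℕ.m≤m*n M d) (ℕ.m≤n+m (M ℕ.* d) p)))))))
        (ℚ.*-zeroʳ (f M))

  -- The contribution of the cycle length p+1 to R u j / u! when j steps of the cycle are made:
  -- it is 2^(p∸j) T(u∸(p∸j)), read as 0 unless j ≤ p ≤ j + u.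
  completion : (ℕ → ℚ) → ℕ → ℕ → ℕ → ℚ
  completion T p       zero    u = cast (2 ^ p) * shift p T u
  completion T zero    (suc j) u = 0ℚ
  completion T (suc p) (suc j) u = completion T p j u

  ≟-suc : ∀ p j → ⟦ suc p ℕ.≟ suc j ⟧ ≡ ⟦ p ℕ.≟ j ⟧
  ≟-suc p j = ⟦⟧-cong ℕ.suc-injective (cong suc) (suc p ℕ.≟ suc j) (p ℕ.≟ j)

  completion-zero : ∀ T p j → completion T p j 0 ≡ ⟦ p ℕ.≟ j ⟧ * T 0
  completion-zero T zero    zero    = refl
  completion-zero T (suc p) zero    = trans (ℚ.*-zeroʳ (cast (2 ^ suc p))) (sym (ℚ.*-zeroˡ (T 0)))
  completion-zero T zero    (suc j) = sym (ℚ.*-zeroˡ (T 0))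
  completion-zero T (suc p) (suc j) = trans (completion-zero T p j) (cong (_* T 0) (sym (≟-suc p j)))

  -- The recursion of `R` divided by (u+1)!, one cycle length at a time: from the 2(u+1) choices of
  -- the next point the factorial absorbs u + 1 and leaves the factor 2.
  completion-suc : ∀ T p j u →
    completion T p j (suc u) ≡ ⟦ p ℕ.≟ j ⟧ * T (suc u) + cast 2 * completion T p (suc j) u
  completion-suc T zero    zero    u = solve 1 (λ t → con 1ℚ :* t := con 1ℚ :* t :+ con (cast 2) :* con 0ℚ) refl (T (suc u))
    where open ℚ.+-*-Solver
  completion-suc T (suc p) zero    u = begin
    cast (2 ℕ.* 2 ^ p) * x                     ≡⟨ cong (_* x) (cast-* 2 (2 ^ p)) ⟩
    cast 2 * cast (2 ^ p) * x
      ≡⟨ solve 4 (λ c t x y → c :* t :* x := con 0ℚ :* y :+ c :* (t :* x)) refl (cast 2) (cast (2 ^ p)) x (T (suc u)) ⟩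
    0ℚ * T (suc u) + cast 2 * (cast (2 ^ p) * x) ∎
    where
    open ℚ.+-*-Solver
    x : ℚ
    x = shift p T u
  completion-suc T zero    (suc j) u = solve 1 (λ t → con 0ℚ := con 0ℚ :* t :+ con (cast 2) :* con 0ℚ) refl (T (suc u))
    where open ℚ.+-*-Solver
  completion-suc T (suc p) (suc j) u = trans (completion-suc T p j u)
    (cong (λ s → s * T (suc u) + cast 2 * completion T p (suc j) u) (sym (≟-suc p j)))

  -- The recursions of `Q` and `R` solved by the coefficients.

  module _ (ps : List ℕ) (M : ℕ) where

    private
      T : ℕ → ℚ
      T = coeff ps M

      -- The multiplicity of `j` in `ps`. In this form the weight of closing an orbit is a sum over
      -- `ps`, as is the right-hand side of `coeff-derivative`.
      χ : ℕ → ℕ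
      χ j = ∑ℕ.∑ ps (λ p → ∑ℕ.⟦ p ℕ.≟ j ⟧)

      cast-χ : ∀ j → cast (χ j) ≡ ∑ ps (λ p → ⟦ p ℕ.≟ j ⟧)
      cast-χ j = trans (cast-∑ ps (λ p → ∑ℕ.⟦ p ℕ.≟ j ⟧)) (∑-cong ps (λ p → cast-⟦⟧ (p ℕ.≟ j)))

    mutual

      Q-coeff : ∀ u → u ≤ M → cast (Q χ u) ≡ cast (u !) * T u
      Q-coeff zero    _   = sym (trans (ℚ.*-identityˡ (T 0)) (coeff-0 ps M))
      Q-coeff (suc u) u<M = begin
        cast (R χ u 0)
          ≡⟨ R-coeff u 0 (ℕ.<⇒≤ u<M) ⟩
        cast (u !) * ∑ ps (λ p → cast (2 ^ p) * shift p T u)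
          -- By definition `shift (suc p) T (suc u)` is `shift p T u`, so this sum is the
          -- logarithmic derivative in degree u + 1.
          ≡⟨ cong (cast (u !) *_) (coeff-derivative ps M (suc u) u<M) ⟨
        cast (u !) * (cast (suc u) * T (suc u))
          ≡⟨ solve 3 (λ x y z → x :* (y :* z) := y :* x :* z) refl (cast (u !)) (cast (suc u)) (T (suc u)) ⟩
        cast (suc u) * cast (u !) * T (suc u)
          ≡⟨ cong (_* T (suc u)) (cast-* (suc u) (u !)) ⟨
        cast (suc u !) * T (suc u) ∎
        where open ℚ.+-*-Solver

      R-coeff : ∀ u j → u ≤ M → cast (R χ u j) ≡ cast (u !) * ∑ ps (λ p → completion T p j u)
      R-coeff zero    j _   = begin
        cast (χ j ℕ.* 1)
          ≡⟨ cong cast (ℕ.*-identityʳ (χ j)) ⟩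
        cast (χ j)
          ≡⟨ cast-χ j ⟩
        ∑ ps (λ p → ⟦ p ℕ.≟ j ⟧)
          ≡⟨ ∑-cong ps (λ p → trans (completion-zero T p j) (trans (cong (⟦ p ℕ.≟ j ⟧ *_) (coeff-0 ps M)) (ℚ.*-identityʳ _))) ⟨
        ∑ ps (λ p → completion T p j 0)
          ≡⟨ ℚ.*-identityˡ _ ⟨
        1ℚ * ∑ ps (λ p → completion T p j 0) ∎
      R-coeff (suc u) j u<M = begin
        cast (χ j ℕ.* Q χ (suc u) ℕ.+ suc u ℕ.* 2 ℕ.* R χ u (suc j))
          ≡⟨ cast-+ (χ j ℕ.* Q χ (suc u)) (suc u ℕ.* 2 ℕ.* R χ u (suc j)) ⟩
        cast (χ j ℕ.* Q χ (suc u)) + cast (suc u ℕ.* 2 ℕ.* R χ u (suc j))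
          ≡⟨ cong₂ _+_ (trans (cast-* (χ j) (Q χ (suc u))) (cong₂ _*_ (cast-χ j) (Q-coeff (suc u) u<M)))
                       (trans (cast-* (suc u ℕ.* 2) (R χ u (suc j)))
                         (cong₂ _*_ (cast-* (suc u) 2) (R-coeff u (suc j) (ℕ.<⇒≤ u<M)))) ⟩
        X * (cast (suc u !) * t) + cast (suc u) * cast 2 * (cast (u !) * Y)
          ≡⟨ cong (λ s → X * (s * t) + cast (suc u) * cast 2 * (cast (u !) * Y)) (cast-* (suc u) (u !)) ⟩
        X * (cast (suc u) * cast (u !) * t) + cast (suc u) * cast 2 * (cast (u !) * Y)
          ≡⟨ solve 6 (λ X t Y s f c → X :* (s :* f :* t) :+ s :* c :* (f :* Y) := s :* f :* (X :* t :+ c :* Y))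
               refl X t Y (cast (suc u)) (cast (u !)) (cast 2) ⟩
        cast (suc u) * cast (u !) * (X * t + cast 2 * Y)
          ≡⟨ cong₂ _*_ (cast-* (suc u) (u !))
               (trans (∑-+ ps _ _) (cong₂ _+_ (∑-*ʳ t ps (λ p → ⟦ p ℕ.≟ j ⟧)) (∑-*ˡ (cast 2) ps (λ p → completion T p (suc j) u)))) ⟨
        cast (suc u !) * ∑ ps (λ p → ⟦ p ℕ.≟ j ⟧ * t + cast 2 * completion T p (suc j) u)
          ≡⟨ cong (cast (suc u !) *_) (∑-cong ps (λ p → completion-suc T p j u)) ⟨
        cast (suc u !) * ∑ ps (λ p → completion T p j (suc u)) ∎
        where
        open ℚ.+-*-Solver hiding (⟦_⟧)
        t X Y : ℚ
        t = T (suc u)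
        X = ∑ ps (λ p → ⟦ p ℕ.≟ j ⟧)
        Y = ∑ ps (λ p → completion T p (suc j) u)

-- The decreasing permutation and the divisors of k.

open Counting
open RootCounting
open Valuation
open ExponentialFormula
open ≡-Reasoning

IsDivPred : ℕ → ℕ → Set
IsDivPred k p = suc p ∣ k × v2 (suc p) ≡ v2 k

isDivPred? : ∀ k p → Dec (IsDivPred k p)
isDivPred? k p = (suc p ∣? k) ×-dec (v2 (suc p) ℕ.≟ v2 k)

-- A filtered range has no repetitions, and a divisor j + 1 of k satisfies j < k, so it is not
-- missed by the range.
∑-divPreds-≟ : ∀ k → 0 < k → ∀ j → ∑ℕ.∑ (divPreds k) (λ p → ∑ℕ.⟦ p ℕ.≟ j ⟧) ≡ ∑ℕ.⟦ isDivPred? k j ⟧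
∑-divPreds-≟ k 0<k j = trans (∑-filter (isDivPred? k) (upTo k) (λ p → ⟦ p ℕ.≟ j ⟧))
  (trans (∑-cong (upTo k) replace) (trans (∑-*ˡ ⟦ isDivPred? k j ⟧ (upTo k) (λ p → ⟦ p ℕ.≟ j ⟧)) occurs))
  where
  open ∑ℕ
  replace : ∀ p → ⟦ isDivPred? k p ⟧ ℕ.* ⟦ p ℕ.≟ j ⟧ ≡ ⟦ isDivPred? k j ⟧ ℕ.* ⟦ p ℕ.≟ j ⟧
  replace p with p ℕ.≟ j
  ... | yes refl = refl
  ... | no _     = trans (ℕ.*-zeroʳ ⟦ isDivPred? k p ⟧) (sym (ℕ.*-zeroʳ ⟦ isDivPred? k j ⟧))
  occurs : ⟦ isDivPred? k j ⟧ ℕ.* ∑ (upTo k) (λ p → ⟦ p ℕ.≟ j ⟧) ≡ ⟦ isDivPred? k j ⟧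
  occurs with isDivPred? k j
  ... | no _         = refl
  ... | yes (j∣k , _) = trans (ℕ.*-identityˡ _) (∑-upTo-≟ (∣⇒≤ {{ℕ.>-nonZero 0<k}} j∣k))

opposite-fixed⇒ : ∀ {n} (z : Fin n) → opposite z ≡ z → n ≡ suc (toℕ z ℕ.* 2)
opposite-fixed⇒ {n} z eq = begin
  n                              ≡⟨ ℕ.m∸n+n≡m (Fin.toℕ<n z) ⟨
  n ∸ suc (toℕ z) ℕ.+ suc (toℕ z)
    ≡⟨ cong (ℕ._+ suc (toℕ z)) (trans (sym (Fin.opposite-prop z)) (cong toℕ eq)) ⟩
  toℕ z ℕ.+ suc (toℕ z)          ≡⟨ ℕ.+-suc (toℕ z) (toℕ z) ⟩
  suc (toℕ z ℕ.+ toℕ z)          ≡⟨ cong (λ s → suc (toℕ z ℕ.+ s)) (ℕ.+-identityʳ (toℕ z)) ⟨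
  suc (2 ℕ.* toℕ z)              ≡⟨ cong suc (ℕ.*-comm 2 (toℕ z)) ⟩
  suc (toℕ z ℕ.* 2)              ∎

opposite-fixed⇐ : ∀ {n} (z : Fin n) → n ≡ suc (toℕ z ℕ.* 2) → opposite z ≡ z
opposite-fixed⇐ {n} z eq = Fin.toℕ-injective (begin
  toℕ (opposite z)                  ≡⟨ Fin.opposite-prop z ⟩
  n ∸ suc (toℕ z)                   ≡⟨ cong (_∸ suc (toℕ z)) eq ⟩
  toℕ z ℕ.* 2 ∸ toℕ z
    ≡⟨ cong (_∸ toℕ z) (trans (ℕ.*-comm (toℕ z) 2) (cong (toℕ z ℕ.+_) (ℕ.+-identityʳ (toℕ z)))) ⟩
  toℕ z ℕ.+ toℕ z ∸ toℕ z           ≡⟨ ℕ.m+n∸n≡m (toℕ z) (toℕ z) ⟩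
  toℕ z                             ∎)

opposite-fixed-unique : ∀ {n} {y z : Fin n} → opposite y ≡ y → opposite z ≡ z → y ≡ z
opposite-fixed-unique {y = y} {z} fy fz = Fin.toℕ-injective
  (ℕ.*-cancelʳ-≡ _ _ 2 (ℕ.suc-injective (trans (sym (opposite-fixed⇒ y fy)) (opposite-fixed⇒ z fz))))

#-opposite-moved : ∀ n → # {n} (λ z → ¬? (opposite z Fin.≟ z)) ≡ n ℕ./ 2 ℕ.* 2
#-opposite-moved n with even⊎odd n
... | inj₁ (h , refl) = begin
  # (¬? ∘ fixed?)
    ≡⟨ cong (ℕ._+ # (¬? ∘ fixed?)) (#≡0 fixed? (λ z eq → even≢odd h (toℕ z) (opposite-fixed⇒ z eq))) ⟨
  # fixed? ℕ.+ # (¬? ∘ fixed?)      ≡⟨ #-complement fixed? ⟩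
  h ℕ.* 2                           ≡⟨ cong (ℕ._* 2) (m*n/n≡m h 2) ⟨
  h ℕ.* 2 ℕ./ 2 ℕ.* 2               ∎
  where
  fixed? : Decidable (λ (z : Fin (h ℕ.* 2)) → opposite z ≡ z)
  fixed? z = opposite z Fin.≟ z
... | inj₂ (h , refl) = ℕ.suc-injective (begin
  suc (# (¬? ∘ fixed?))
    ≡⟨ cong (ℕ._+ # (¬? ∘ fixed?)) (#≡1 fixed? mid mid-fixed (λ z eq → opposite-fixed-unique eq mid-fixed)) ⟨
  # fixed? ℕ.+ # (¬? ∘ fixed?)      ≡⟨ #-complement fixed? ⟩
  suc (h ℕ.* 2)                     ≡⟨ m≡m%n+[m/n]*n (suc (h ℕ.* 2)) 2 ⟩
  suc (h ℕ.* 2) ℕ.% 2 ℕ.+ suc (h ℕ.* 2) ℕ./ 2 ℕ.* 2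
                                    ≡⟨ cong (ℕ._+ suc (h ℕ.* 2) ℕ./ 2 ℕ.* 2) ([m+kn]%n≡m%n 1 h 2) ⟩
  suc (suc (h ℕ.* 2) ℕ./ 2 ℕ.* 2)   ∎)
  where
  fixed? : Decidable (λ (z : Fin (suc (h ℕ.* 2))) → opposite z ≡ z)
  fixed? z = opposite z Fin.≟ z
  mid : Fin (suc (h ℕ.* 2))
  mid = fromℕ< (s≤s (ℕ.m≤m*n h 2))
  mid-fixed : opposite mid ≡ mid
  mid-fixed = opposite-fixed⇐ mid (cong (λ s → suc (s ℕ.* 2)) (sym (Fin.toℕ-fromℕ< (s≤s (ℕ.m≤m*n h 2)))))

countRoots≡Q : ∀ k n → 0 < k → countRoots k n ≡ Q (λ j → ∑ℕ.⟦ isDivPred? k j ⟧) (n ℕ./ 2)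
countRoots≡Q k@(suc k-1) n 0<k = begin
  countRoots k n
    ≡⟨ length-filter (good? k) (allVecs n n) ⟩
  ∑ (allVecs n n) (λ v → ⟦ good? k v ⟧)
    ≡⟨ ∑-cong (allVecs n n) (λ v → ⟦⟧-cong proj₂ (λ rt → (λ i j → root-injective rt) , rt) (good? k v)
         (Fin.all? (λ i → pow (lookup v) k i Fin.≟ w₀ i))) ⟩
  ∑ (allVecs n n) (λ v → ⟦ Fin.all? (λ i → pow (lookup v) k i Fin.≟ w₀ i) ⟧)
    ≡⟨ count-roots opposite-fixed-unique (n ℕ./ 2) (#-opposite-moved n) ⟩
  Q (λ j → ⟦ isDivPred? k j ⟧) (n ℕ./ 2) ∎
  where
  open ∑ℕ
  open Roots (w₀ {n}) Fin.opposite-involutive k-1 (isDivPred? k) (odd-quotient⇔ 0<k)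

-- Taking both the bound and the degree to be ⌊n/2⌋ makes the tuples of `coeff` those from which `S`
-- is filtered.
formula≡coeff : ∀ k n → formula k n ≡ cast ((n ℕ./ 2) !) * coeff (divPreds k) (n ℕ./ 2) (n ℕ./ 2)
formula≡coeff k n = trans (∑-*ˡ (cast (m !)) (S k n) P)
  (cong (cast (m !) *_) (∑-filter (λ as → weighted (divPreds k) as ℕ.≟ m) (tuples (length (divPreds k)) m) P))
  where
  open ∑ℚ
  m : ℕ
  m = n ℕ./ 2
  P : List ℕ → ℚ
  P as = prodℚ (zipWith factor (divPreds k) as)

theorem1p5 : (k n : ℕ) → 1 ≤ k → 1 ≤ n → (+ countRoots k n) / 1 ≡ formula k n
theorem1p5 k n 1≤k 1≤n = begin
  cast (countRoots k n)
    ≡⟨ cong cast (countRoots≡Q k n 1≤k) ⟩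
  cast (Q (λ j → ∑ℕ.⟦ isDivPred? k j ⟧) (n ℕ./ 2))
    ≡⟨ cong cast (Q-cong (∑-divPreds-≟ k 1≤k) (n ℕ./ 2)) ⟨
  cast (Q (λ j → ∑ℕ.∑ (divPreds k) (λ p → ∑ℕ.⟦ p ℕ.≟ j ⟧)) (n ℕ./ 2))
    ≡⟨ Q-coeff (divPreds k) (n ℕ./ 2) (n ℕ./ 2) ℕ.≤-refl ⟩
  cast ((n ℕ./ 2) !) * coeff (divPreds k) (n ℕ./ 2) (n ℕ./ 2)
    ≡⟨ formula≡coeff k n ⟨
  formula k n ∎
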